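{- Among the patterns of length four that avoid $1324$, the $f$-compatible ones are exactly $$1432,\ 4231,\ 4321,$$ and among the patterns of length five that avoid $1324$, the $f$-compatible ones are exactly $$14523,\ 14532,\ 15342,\ 15423,\ 15432,\ 34125,\ 52341,\ 52431,\ 53241,\ 53421,\ 54231,\ 54321.$$ Furthermore, if $p\in S_m$ is any pattern such that $p_1=m$ and $p_m=1$, then $p$ is $f$-compatible.
   Context: Notation. $\mathrm{Av}(B)$ is the set of permutations avoiding all patterns in $B$ (no subsequence order-isomorphic to a pattern in $B$). For $\pi\in S_n$ and a value $e\in[n]$, $\pi\smallsetminus e$ is the permutation order-isomorphic to the sequence obtained by deleting the entry with value $e$ from $\pi$. The direct sum $\sigma\oplus\tau$ of $\sigma\in S_a,\tau\in S_b$ is $\sigma$ followed by $\tau$ with all values shifted up by $a$. A permutation is decomposable if it is a direct sum of two nonempty permutations, and indecomposable otherwise. $\mathrm{id}_m$ is the identity permutation of length $m$ ($\mathrm{id}_0$ is empty). The reverse-complement of $\pi\in S_n$ is $\pi^{\mathrm{rc}}$ with $\pi^{\mathrm{rc}}_i=n+1-\pi_{n+1-i}$. A permutation $\pi\in S_n$ is almost decomposable if it is indecomposable but $\pi\smallsetminus e$ is decomposable for some $e\in\{1,\pi_1,n,\pi_n\}$. The map $f$. Every decomposable $1324$-avoider can be written uniquely as $\pi=\sigma\oplus\mathrm{id}_m\oplus\tau$ with $m\ge0$, $\sigma$ an indecomposable $132$-avoider and $\tau$ an indecomposable $213$-avoider (both nonempty); set $\widetilde f(\pi)=\sigma\oplus\mathrm{id}_{m+1}\oplus\tau$.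 For a decomposable $1324$-avoider set $f(\pi)=\widetilde f(\pi)$. For an almost decomposable $1324$-avoider $\pi$ define $f(\pi)$ (of length $|\pi|+1$) as follows: (1) if $\pi\smallsetminus\pi_1$ is decomposable, $f(\pi)$ is the permutation with $f(\pi)_1=\pi_1$ and $f(\pi)\smallsetminus\pi_1=\widetilde f(\pi\smallsetminus\pi_1)$; (2) if $\pi\smallsetminus 1$ is decomposable, $f(\pi)=f(\pi^{ -1})^{ -1}$; (3) otherwise (both $\pi\smallsetminus\pi_1$ and $\pi\smallsetminus1$ indecomposable), $f(\pi)=f(\pi^{\mathrm{rc}})^{\mathrm{rc}}$. (For almost decomposable $1324$-avoiders, cases (1) and (2) cannot occur simultaneously.) A pattern $p$ is $f$-compatible if $f(\pi)$ avoids $p$ for every decomposable or almost decomposable permutation $\pi\in\mathrm{Av}(1324,p)$. -}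

module Defs where

open import Data.Nat.Base using (ℕ; zero; suc; _+_)
open import Data.Fin.Base using (Fin; toℕ; fromℕ; inject₁; _<_)
open import Data.Fin.Patterns using (0F; 1F; 2F)
open import Data.Fin.Permutation
  using (Permutation′; _⟨$⟩ʳ_; _⟨$⟩ˡ_; _≈_; _∘ₚ_; id; flip; remove; reverse; transpose)
open import Data.Fin.Properties using (+↔⊎)
open import Data.List.Base using (List; []; _∷_; tabulate)
open import Data.List.Membership.Propositional using (_∈_)
open import Data.Product.Base using (Σ-syntax; ∃-syntax; _×_)
open import Data.Sum.Base using (_⊎_)
open import Data.Sum.Function.Propositional using (_⊎-↔_)
open import Data.Empty using (⊥)
open import Function.Bundles using (_⇔_)
open import Function.Construct.Composition using (_↔-∘_)
open import Function.Construct.Symmetry using (↔-sym)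
open import Relation.Binary.Core using (_Preserves_⟶_)
open import Relation.Binary.PropositionalEquality.Core using (_≡_; refl)
open import Relation.Nullary.Negation.Core using (¬_)

-- Positions and values of π ∈ Sₙ are counted from 0: the i-th entry of π is
-- π ⟨$⟩ʳ (i - 1), and the value v is the element v - 1 of Fin n.

-- One-line notation, with values counted from 1.
oneLine : ∀ {n} → Permutation′ n → List ℕ
oneLine π = tabulate (λ i → suc (toℕ (π ⟨$⟩ʳ i)))

-- Equality of permutations whose lengths need not be definitionally equal.
infix 4 _≋_
_≋_ : ∀ {m n} → Permutation′ m → Permutation′ n → Set
π ≋ ρ = oneLine π ≡ oneLine ρ

Contains : ∀ {n k} → Permutation′ n → Permutation′ k → Set
Contains {n} {k} π p =
  Σ[ e ∈ (Fin k → Fin n) ]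
    (e Preserves _<_ ⟶ _<_) ×
    (∀ i j → (p ⟨$⟩ʳ i) < (p ⟨$⟩ʳ j) ⇔ (π ⟨$⟩ʳ e i) < (π ⟨$⟩ʳ e j))

Avoids : ∀ {n k} → Permutation′ n → Permutation′ k → Set
Avoids π p = ¬ Contains π p

[132] : Permutation′ 3
[132] = transpose 1F 2F

[213] : Permutation′ 3
[213] = transpose 0F 1F

[1324] : Permutation′ 4
[1324] = transpose 1F 2F

_ : oneLine [132] ≡ 1 ∷ 3 ∷ 2 ∷ []
_ = refl

_ : oneLine [213] ≡ 2 ∷ 1 ∷ 3 ∷ []
_ = refl

_ : oneLine [1324] ≡ 1 ∷ 3 ∷ 2 ∷ 4 ∷ []
_ = refl

-- `remove` deletes the entry at a given position, so the value e is deleted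
-- by removing its position π⁻¹(e).
infixl 6 _∖_
_∖_ : ∀ {n} → Permutation′ (suc n) → Fin (suc n) → Permutation′ n
π ∖ e = remove (π ⟨$⟩ˡ e) π

infixr 6 _⊕_
_⊕_ : ∀ {a b} → Permutation′ a → Permutation′ b → Permutation′ (a + b)
σ ⊕ τ = ↔-sym +↔⊎ ↔-∘ ((σ ⊎-↔ τ) ↔-∘ +↔⊎)

rc : ∀ {n} → Permutation′ n → Permutation′ n
rc π = reverse ∘ₚ π ∘ₚ reverse

Decomposable : ∀ {n} → Permutation′ n → Set
Decomposable π =
  ∃[ a ] ∃[ b ] Σ[ σ ∈ Permutation′ (suc a) ] Σ[ τ ∈ Permutation′ (suc b) ] π ≋ σ ⊕ τ

Indecomposable : ∀ {n} → Permutation′ n → Set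
Indecomposable π = ¬ Decomposable π

AlmostDecomposable : ∀ {n} → Permutation′ n → Set
AlmostDecomposable {zero}  π = ⊥
AlmostDecomposable {suc n} π =
  Indecomposable π ×
  ∃[ e ] e ∈ (first ∷ (π ⟨$⟩ʳ first) ∷ last ∷ (π ⟨$⟩ʳ last) ∷ []) × Decomposable (π ∖ e)
  where
  first last : Fin (suc n)
  first = 0F
  last  = fromℕ n

-- π f̃↦ ρ means f̃(π) = ρ; the existence of σ, m, τ already makes π a
-- decomposable 1324-avoider.
infix 4 _f̃↦_
data _f̃↦_ {n} (π : Permutation′ n) (ρ : Permutation′ (suc n)) : Set where
  enlarge : ∀ {a b} m (σ : Permutation′ (suc a)) (τ : Permutation′ (suc b)) →
            Indecomposable σ → Avoids σ [132] →
            Indecomposable τ → Avoids τ [213] →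
            π ≋ σ ⊕ (id {m} ⊕ τ) →
            ρ ≋ σ ⊕ (id {suc m} ⊕ τ) →
            π f̃↦ ρ

-- π f↦ ρ means f(π) = ρ. In case₂ (case₃) the inner derivation can only end
-- with case₁ (with case₁ or case₂), so the recursion stops.
infix 4 _f↦_
data _f↦_ : ∀ {n} → Permutation′ n → Permutation′ (suc n) → Set where
  decomposable :
    ∀ {n} {π : Permutation′ n} {ρ} →
    Avoids π [1324] → Decomposable π →
    π f̃↦ ρ →
    π f↦ ρ
  case₁ :
    ∀ {n} {π : Permutation′ (suc n)} {ρ : Permutation′ (suc (suc n))} →
    Avoids π [1324] → AlmostDecomposable π →
    Decomposable (π ∖ (π ⟨$⟩ʳ 0F)) →
    ρ ⟨$⟩ʳ 0F ≡ inject₁ (π ⟨$⟩ʳ 0F) →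
    π ∖ (π ⟨$⟩ʳ 0F) f̃↦ ρ ∖ inject₁ (π ⟨$⟩ʳ 0F) →
    π f↦ ρ
  case₂ :
    ∀ {n} {π : Permutation′ (suc n)} {ρ ρ′ : Permutation′ (suc (suc n))} →
    Avoids π [1324] → AlmostDecomposable π →
    Decomposable (π ∖ 0F) →
    flip π f↦ ρ′ → ρ ≈ flip ρ′ →
    π f↦ ρ
  case₃ :
    ∀ {n} {π : Permutation′ (suc n)} {ρ ρ′ : Permutation′ (suc (suc n))} →
    Avoids π [1324] → AlmostDecomposable π →
    Indecomposable (π ∖ (π ⟨$⟩ʳ 0F)) → Indecomposable (π ∖ 0F) →
    rc π f↦ ρ′ → ρ ≈ rc ρ′ →
    π f↦ ρ

-- Every decomposable or almost decomposable 1324-avoider π has exactly one ρ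
-- with π f↦ ρ (up to ≈), so "for all such ρ" speaks about f(π).
FCompatible : ∀ {k} → Permutation′ k → Set
FCompatible p =
  ∀ {n} (π : Permutation′ n) → Decomposable π ⊎ AlmostDecomposable π →
  Avoids π [1324] → Avoids π p →
  ∀ (ρ : Permutation′ (suc n)) → π f↦ ρ → Avoids ρ p

{-# OPTIONS --safe #-}
-- In the cases where f is applied directly, the map inserts an entry c between
-- two blocks of π (or of π without its first entry), the left one below and
-- before c, the right one above and after c and avoiding 213. An occurrence of
-- p in f(π) that misses c is an occurrence in π, up to the first entry, which
-- can only have moved down within the right block. No inversion involves c or
-- two blocks, so a part of p whose inversion graph is connected misses c and
-- stays within one block; a single remaining smallest first or largest last
-- entry of p can be moved into the other block. The classes of patterns treated
-- in this way are closed under inverses, and reverse-complement exchanges them,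
-- so they pass through the symmetries in the definition of f. All other patterns
-- are refuted by explicit permutations π of length at most 7.
module Submission where

open import Data.Empty using (⊥)
open import Data.Fin.Base
  using (Fin; zero; suc; toℕ; fromℕ; fromℕ<; inject₁; opposite; punchIn; punchOut;
         splitAt; _↑ˡ_; _↑ʳ_; _<_; _≤_)
open import Data.Fin.Patterns using (0F; 1F; 2F; 3F; 4F; 5F; 6F; 7F)
open import Data.Fin.Permutation
  using (Permutation′; permutation; _⟨$⟩ʳ_; _⟨$⟩ˡ_; _≈_; id; flip; remove; insert;
         insert-remove; inverseˡ; inverseʳ; punchIn-permute; punchIn-permute′)
open import Data.Fin.Properties as Fin using (_≟_; _<?_; toℕ-injective)
open import Data.List.Base using (List; []; _∷_; allFin; cartesianProductWith; length; tabulate)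
open import Data.List.Membership.Propositional using (_∈_)
open import Data.List.Membership.Propositional.Properties using (∈-allFin)
import Data.List.Membership.DecPropositional as DecMembership
import Data.List.Properties as List
open import Data.List.Relation.Unary.All as All using (All)
open import Data.List.Relation.Unary.Any as Any using (Any; here)
open import Data.List.Relation.Unary.Any.Properties using (cartesianProductWith⁺; lookup-result)
open import Data.Nat.Base as ℕ using (ℕ; zero; suc; _+_)
import Data.Nat.Properties as ℕ
open import Data.Product.Base using (Σ-syntax; ∃-syntax; _×_; _,_; proj₁; proj₂)
open import Data.Sum.Base using (_⊎_; inj₁; inj₂; [_,_]′)
open import Data.Unit.Base using (⊤; tt)
open import Data.Vec.Base as Vec using (Vec; []; _∷_)
import Data.Vec.Properties as Vec
open import Function.Base using (_∘_; _on_)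
open import Function.Bundles using (_⇔_; mk⇔; module Equivalence)
open import Relation.Binary.Definitions using (tri<; tri≈; tri>)
open import Relation.Binary.PropositionalEquality
open import Relation.Nullary using (¬_; Dec; yes; no; contradiction)
open import Relation.Nullary.Decidable
  using (True; toWitness; map′; _×-dec_; _⊎-dec_; _→-dec_; ¬?)
open import Defs

-- The obstacle is that reverse-complement does not preserve compatibility: 1432 is compatible, but
-- its reverse-complement 3214 is not, since f sends 634125 to 6341257. Case (3) of f nevertheless
-- turns questions about 1432 into questions about 3214. The rescue is that case (3) is entered only
-- when deleting the first entry and deleting 1 both leave an indecomposable permutation. After
-- reverse-complement, neither the last entry nor the largest one decomposes the permutation; so in
-- case (1) the first entry is not the largest (in 634125 it is), and an entry above it can play the
-- 4. Hence two classes of patterns: one is pulled back unconditionally, the other under this extra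
-- hypothesis. The first entry can move down because it keeps its value while the values above the
-- inserted entry rise by one. So being below the first entry passes from f(π) back to π, being
-- above it does not. An occurrence relying on the latter is rebuilt with another smallest or
-- largest entry, or is excluded because it would put a 213 into the right block.

private
  variable
    k n m a b : ℕ

-- Occurrences

-- Patterns and permutations are treated as ℕ-valued sequences, so that what remains after dropping
-- an entry can be used as it is, without standardizing.
val : Permutation′ n → Fin n → ℕ
val π i = toℕ (π ⟨$⟩ʳ i)

⟨$⟩ʳ-injective : (π : Permutation′ n) → ∀ {i j} → π ⟨$⟩ʳ i ≡ π ⟨$⟩ʳ j → i ≡ j
⟨$⟩ʳ-injective π eq = trans (sym (inverseˡ π)) (trans (cong (π ⟨$⟩ˡ_) eq) (inverseˡ π))

val-injective : (π : Permutation′ n) → ∀ {i j} → val π i ≡ val π j → i ≡ j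
val-injective π = ⟨$⟩ʳ-injective π ∘ toℕ-injective

toℕ-punchIn-< : ∀ (c : Fin (suc n)) i → toℕ i ℕ.< toℕ c → toℕ (punchIn c i) ≡ toℕ i
toℕ-punchIn-< (suc c) zero    _           = refl
toℕ-punchIn-< (suc c) (suc i) (ℕ.s≤s i<c) = cong suc (toℕ-punchIn-< c i i<c)

toℕ-punchIn-≥ : ∀ (c : Fin (suc n)) i → toℕ c ℕ.≤ toℕ i → toℕ (punchIn c i) ≡ suc (toℕ i)
toℕ-punchIn-≥ zero    i       _           = refl
toℕ-punchIn-≥ (suc c) (suc i) (ℕ.s≤s c≤i) = cong suc (toℕ-punchIn-≥ c i c≤i)

punchIn-mono-< : ∀ (c : Fin (suc n)) {i j} → i < j → punchIn c i < punchIn c j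
punchIn-mono-< c {i} {j} i<j =
  ℕ.≰⇒> λ le → ℕ.<⇒≱ i<j (Fin.punchIn-cancel-≤ c j i le)

punchIn-cancel-< : ∀ (c : Fin (suc n)) {i j} → punchIn c i < punchIn c j → i < j
punchIn-cancel-< c {i} {j} lt =
  ℕ.≰⇒> λ le → ℕ.<⇒≱ lt (Fin.punchIn-mono-≤ c j i le)

punchIn-<⇒< : ∀ (c : Fin (suc n)) {i} → punchIn c i < c → toℕ i ℕ.< toℕ c
punchIn-<⇒< c {i} lt = ℕ.≰⇒> λ le →
  ℕ.<⇒≱ lt (ℕ.≤-trans le (ℕ.≤-trans (ℕ.n≤1+n _) (ℕ.≤-reflexive (sym (toℕ-punchIn-≥ c i le)))))

punchIn->⇒≥ : ∀ (c : Fin (suc n)) {i} → c < punchIn c i → toℕ c ℕ.≤ toℕ i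
punchIn->⇒≥ c {i} lt = ℕ.≮⇒≥ λ i<c →
  ℕ.<-asym i<c (subst (toℕ c ℕ.<_) (toℕ-punchIn-< c i i<c) lt)

-- For injective p the converse of `ordered` is automatic.
record Occ (p : Fin k → ℕ) (f : Fin n → ℕ) : Set where
  constructor occ
  field
    at      : Fin k → Fin n
    mono    : ∀ {i j} → i < j → at i < at j
    ordered : ∀ {i j} → p i ℕ.< p j → f (at i) ℕ.< f (at j)

open Occ

contains⇒occ : ∀ {π : Permutation′ n} {p : Permutation′ k} → Contains π p → Occ (val p) (val π)
contains⇒occ (e , e-mono , e-order) = occ e e-mono (Equivalence.to (e-order _ _))

occ⇒contains : ∀ {π : Permutation′ n} {p : Permutation′ k} → Occ (val p) (val π) → Contains π p
occ⇒contains {π = π} {p} (occ e e-mono e-ordered) =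
  e , e-mono , λ i j → mk⇔ e-ordered (reflect i j)
  where
  reflect : ∀ i j → val π (e i) ℕ.< val π (e j) → val p i ℕ.< val p j
  reflect i j lt with ℕ.<-cmp (val p i) (val p j)
  ... | tri< pi<pj _ _ = pi<pj
  ... | tri> _ _ pj<pi = contradiction lt (ℕ.<-asym (e-ordered pj<pi))
  ... | tri≈ _ pi≡pj _ with refl ← val-injective p pi≡pj = contradiction lt (ℕ.<-irrefl refl)

restrict : ∀ {p : Fin (suc k) → ℕ} {f : Fin n → ℕ} (r : Fin (suc k)) →
           Occ p f → Occ (p ∘ punchIn r) f
restrict r (occ e e-mono e-ordered) = occ (e ∘ punchIn r) (e-mono ∘ punchIn-mono-< r) e-ordered

prepend : ∀ {p : Fin (suc k) → ℕ} {f : Fin n → ℕ} (o : Occ (p ∘ suc) f) (x : Fin n) →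
          (∀ i → x < at o i) →
          (∀ i → p (suc i) ℕ.< p 0F → f (at o i) ℕ.< f x) →
          (∀ i → p 0F ℕ.< p (suc i) → f x ℕ.< f (at o i)) → Occ p f
prepend {k = k} {n} {p} {f} o x before below above = occ e e-mono e-ordered
  where
  e : Fin (suc k) → Fin n
  e 0F      = x
  e (suc i) = at o i

  e-mono : ∀ {i j} → i < j → e i < e j
  e-mono {0F}    {suc j} _   = before j
  e-mono {suc i} {suc j} i<j = mono o (ℕ.s<s⁻¹ i<j)

  e-ordered : ∀ {i j} → p i ℕ.< p j → f (e i) ℕ.< f (e j)
  e-ordered {0F}    {0F}    lt = contradiction lt (ℕ.<-irrefl refl)
  e-ordered {0F}    {suc j} lt = above j lt
  e-ordered {suc i} {0F}    lt = below i lt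
  e-ordered {suc i} {suc j} lt = ordered o lt

≢fromℕ⇒< : ∀ {i : Fin (suc k)} → fromℕ k ≢ i → i < fromℕ k
≢fromℕ⇒< {i = i} ≢i = ℕ.≤∧≢⇒< (Fin.≤fromℕ i) (≢i ∘ sym ∘ toℕ-injective)

append : ∀ {p : Fin (suc k) → ℕ} {f : Fin n → ℕ} → (∀ i → p (punchIn (fromℕ k) i) ℕ.< p (fromℕ k)) →
         (o : Occ (p ∘ punchIn (fromℕ k)) f) (x : Fin n) →
         (∀ i → at o i < x) → (∀ i → f (at o i) ℕ.< f x) → Occ p f
append {k = k} {n} {p} {f} p-max o x before below = occ e e-mono e-ordered
  where
  last = fromℕ k

  data View : Fin (suc k) → Set where
    final : View last
    other : ∀ i → View (punchIn last i)

  view : ∀ j → View j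
  view j with last ≟ j
  ... | yes refl = final
  ... | no l≢j   = subst View (Fin.punchIn-punchOut l≢j) (other (punchOut l≢j))

  e′ : ∀ {j} → View j → Fin n
  e′ final     = x
  e′ (other i) = at o i

  e : Fin (suc k) → Fin n
  e j = e′ (view j)

  e-mono : ∀ {i j} → i < j → e i < e j
  e-mono {i} {j} i<j with view i | view j
  ... | final   | _       = contradiction (Fin.≤fromℕ j) (ℕ.<⇒≱ i<j)
  ... | other a | final   = before a
  ... | other a | other b = mono o (punchIn-cancel-< last i<j)

  e-ordered : ∀ {i j} → p i ℕ.< p j → f (e i) ℕ.< f (e j)
  e-ordered {i} {j} lt with view i | view j
  ... | final   | final   = contradiction lt (ℕ.<-irrefl refl)
  ... | final   | other b = contradiction lt (ℕ.<-asym (p-max b))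
  ... | other a | final   = below a
  ... | other a | other b = ordered o lt

later : ∀ {p : Fin k → ℕ} {f : Fin (suc n) → ℕ} → Occ p (f ∘ suc) → Occ p f
later (occ e e-mono e-ordered) = occ (suc ∘ e) (λ i<j → ℕ.s≤s (e-mono i<j)) e-ordered

earlier : ∀ {p : Fin k → ℕ} {f : Fin (suc n) → ℕ} (o : Occ p f) → (∀ i → 0 ℕ.< toℕ (at o i)) →
          Σ[ o′ ∈ Occ p (f ∘ suc) ] (∀ i → suc (at o′ i) ≡ at o i)
earlier {f = f} (occ e e-mono e-ordered) pos =
  occ (λ i → proj₁ (pre i))
      (λ {i} {j} i<j → ℕ.s<s⁻¹ (subst₂ _<_ (sym (proj₂ (pre i))) (sym (proj₂ (pre j))) (e-mono i<j)))
      (λ {i} {j} lt → subst₂ (ℕ._<_ on f) (sym (proj₂ (pre i))) (sym (proj₂ (pre j))) (e-ordered lt))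
  , λ i → proj₂ (pre i)
  where
  pre : ∀ i → Σ[ y ∈ _ ] suc y ≡ e i
  pre i with e i | pos i
  ... | suc y | _ = y , refl

-- Inversion graphs and the insertion of an entry

Edge : (Fin k → ℕ) → Fin k → Fin k → Set
Edge p i j = (i < j × p j ℕ.< p i) ⊎ (j < i × p i ℕ.< p j)

-- A strong form of connectedness, decidable by a finite check: any two entries are joined by at
-- most two edges of the inversion graph. For i = j this demands a neighbour, which excludes
-- isolated entries; the empty pattern is rigid vacuously.
Rigid : (Fin k → ℕ) → Set
Rigid p = ∀ i j → Edge p i j ⊎ (∃[ x ] Edge p i x × Edge p x j)

-- g⁺ arises from g by inserting an entry at position c, above everything
-- before it and below everything after it.
record Stretch (g : Fin n → ℕ) (g⁺ : Fin (suc n) → ℕ) : Set where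
  field
    c         : Fin (suc n)
    left≢∅    : 0 ℕ.< toℕ c
    right≢∅   : toℕ c ℕ.< n
    unstretch : ∀ {i j} → g⁺ (punchIn c i) ℕ.< g⁺ (punchIn c j) → g i ℕ.< g j
    cut       : ∀ {i j} → toℕ i ℕ.< toℕ c → toℕ c ℕ.≤ toℕ j → g i ℕ.< g j
    cut⁺      : ∀ {i j} → i < j → i ≤ c → c ≤ j → g⁺ i ℕ.< g⁺ j
    avoids213 : ∀ {i j l} → c < i → i < j → j < l → g⁺ j ℕ.< g⁺ i → g⁺ i ℕ.< g⁺ l → ⊥

module _ {g : Fin n → ℕ} {g⁺ : Fin (suc n) → ℕ} (S : Stretch g g⁺) where
  open Stretch S

  avoiding-c : ∀ {p : Fin k → ℕ} (o : Occ p g⁺) → (∀ i → c ≢ at o i) →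
               Σ[ o′ ∈ Occ p g ] (∀ i → punchIn c (at o′ i) ≡ at o i)
  avoiding-c o c≢ =
    occ (λ i → punchOut (c≢ i))
        (λ {i} {j} i<j → punchIn-cancel-< c (subst₂ _<_ (sym (eq i)) (sym (eq j)) (mono o i<j)))
        (λ {i} {j} lt → unstretch (subst₂ (ℕ._<_ on g⁺) (sym (eq i)) (sym (eq j)) (ordered o lt)))
    , eq
    where
    eq : ∀ i → punchIn c (punchOut (c≢ i)) ≡ at o i
    eq i = Fin.punchIn-punchOut (c≢ i)

  SameSide : Fin (suc n) → Fin (suc n) → Set
  SameSide i j = (i < c × j < c) ⊎ (c < i × c < j)

  SameSide-sym : ∀ {i j} → SameSide i j → SameSide j i
  SameSide-sym (inj₁ (a , b)) = inj₁ (b , a)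
  SameSide-sym (inj₂ (a , b)) = inj₂ (b , a)

  SameSide-trans : ∀ {i j l} → SameSide i j → SameSide j l → SameSide i l
  SameSide-trans (inj₁ (a , _)) (inj₁ (_ , b)) = inj₁ (a , b)
  SameSide-trans (inj₂ (a , _)) (inj₂ (_ , b)) = inj₂ (a , b)
  SameSide-trans (inj₁ (_ , a)) (inj₂ (b , _)) = contradiction a (ℕ.<-asym b)
  SameSide-trans (inj₂ (_ , a)) (inj₁ (b , _)) = contradiction a (ℕ.<-asym b)

  SameSide⇒c≢ : ∀ {i j} → SameSide i j → c ≢ i
  SameSide⇒c≢ (inj₁ (a , _)) refl = ℕ.<-irrefl refl a
  SameSide⇒c≢ (inj₂ (a , _)) refl = ℕ.<-irrefl refl a

  inversion-SameSide : ∀ {i j} → i < j → g⁺ j ℕ.< g⁺ i → SameSide i j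
  inversion-SameSide {i} {j} i<j inv with ℕ.<-≤-connex (toℕ c) (toℕ i) | ℕ.<-≤-connex (toℕ j) (toℕ c)
  ... | inj₁ c<i | _        = inj₂ (c<i , ℕ.<-trans c<i i<j)
  ... | inj₂ i≤c | inj₁ j<c = inj₁ (ℕ.<-trans i<j j<c , j<c)
  ... | inj₂ i≤c | inj₂ c≤j = contradiction inv (ℕ.<-asym (cut⁺ i<j i≤c c≤j))

  edge-SameSide : ∀ {p : Fin k → ℕ} (o : Occ p g⁺) {i j} → Edge p i j → SameSide (at o i) (at o j)
  edge-SameSide o (inj₁ (i<j , pj<pi)) = inversion-SameSide (mono o i<j) (ordered o pj<pi)
  edge-SameSide o (inj₂ (j<i , pi<pj)) = SameSide-sym (inversion-SameSide (mono o j<i) (ordered o pi<pj))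

  rigid-SameSide : ∀ {p : Fin k → ℕ} → Rigid p → (o : Occ p g⁺) → ∀ i j → SameSide (at o i) (at o j)
  rigid-SameSide rigid o i j with rigid i j
  ... | inj₁ ij            = edge-SameSide o ij
  ... | inj₂ (x , ix , xj) = SameSide-trans (edge-SameSide o ix) (edge-SameSide o xj)

  rigid-avoids-c : ∀ {p : Fin k → ℕ} → Rigid p → (o : Occ p g⁺) → ∀ i → c ≢ at o i
  rigid-avoids-c rigid o i = SameSide⇒c≢ (rigid-SameSide rigid o i i)

  rigid-sides : ∀ {p : Fin k → ℕ} → 0 ℕ.< k → Rigid p → (o : Occ p g⁺) →
                (∀ i → at o i < c) ⊎ (∀ i → c < at o i)
  rigid-sides {k = suc k} 0<k rigid o with rigid-SameSide rigid o 0F 0F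
  ... | inj₁ (a , _) = inj₁ λ i →
    [ proj₂ , (λ (b , _) → contradiction a (ℕ.<-asym b)) ]′ (rigid-SameSide rigid o 0F i)
  ... | inj₂ (a , _) = inj₂ λ i →
    [ (λ (b , _) → contradiction b (ℕ.<-asym a)) , proj₂ ]′ (rigid-SameSide rigid o 0F i)

-- Shapes of patterns

Ends : (Fin (suc (suc k)) → ℕ) → Set
Ends {k} p = (∀ i → p (suc i) ℕ.< p 0F) × (∀ i → p (fromℕ (suc k)) ℕ.< p (punchIn (fromℕ (suc k)) i))

-- `Low` covers patterns such as 1432, `High` their reverse-complements such as 3214. The condition
-- on `k` keeps the connected part nonempty, so that it has a side and contains an inversion.
Low : (Fin (suc k) → ℕ) → Set
Low {k} p = 0 ℕ.< k × (∀ i → p 0F ℕ.< p (suc i)) × Rigid (p ∘ suc)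

High : (Fin (suc k) → ℕ) → Set
High {k} p = 0 ℕ.< k × (∀ i → p (punchIn (fromℕ k) i) ℕ.< p (fromℕ k)) × Rigid (p ∘ punchIn (fromℕ k))

-- The first entry together with the inversion i, j would make the right part
-- contain 213.
Blocked : (Fin (suc k) → ℕ) → Set
Blocked {k} p = ∃[ i ] ∃[ j ] 0 ℕ.< toℕ i × i < j × j < fromℕ k ×
  p 0F ℕ.< p i × p j ℕ.< p i × p i ℕ.< p (fromℕ k)

-- The shape of 3214 and 42315: a connected part below both the first and the last entry. When this
-- part lies left of the inserted entry, no 213 arises; these patterns therefore need an entry above
-- the first one.
Capped : (Fin (suc (suc k)) → ℕ) → Set
Capped {k} p = (∀ i → p (suc (punchIn (fromℕ k) i)) ℕ.< p 0F) × High (p ∘ suc)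

-- The first entry forms an inversion with every other one and so is the midpoint of all the paths.
maxFirst⇒Rigid : ∀ {p : Fin (suc (suc k)) → ℕ} → (∀ i → p (suc i) ℕ.< p 0F) → Rigid p
maxFirst⇒Rigid {p = p} p₀-max = λ where
    0F      0F      → inj₂ (suc 0F , down 0F , up 0F)
    0F      (suc j) → inj₁ (down j)
    (suc i) 0F      → inj₁ (up i)
    (suc i) (suc j) → inj₂ (0F , up i , down j)
  where
  down : ∀ j → Edge p 0F (suc j)
  down j = inj₁ (ℕ.s≤s ℕ.z≤n , p₀-max j)
  up : ∀ i → Edge p (suc i) 0F
  up i = inj₂ (ℕ.s≤s ℕ.z≤n , p₀-max i)

minLast⇒Rigid : ∀ {p : Fin (suc (suc k)) → ℕ} →
  (∀ i → p (fromℕ (suc k)) ℕ.< p (punchIn (fromℕ (suc k)) i)) → Rigid p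
minLast⇒Rigid {k = k} {p} p-min i j = hub (last ≟ i) (last ≟ j)
  where
  last = fromℕ (suc k)
  lower : ∀ {x} → last ≢ x → p last ℕ.< p x
  lower ≢x = subst (λ y → p last ℕ.< p y) (Fin.punchIn-punchOut ≢x) (p-min (punchOut ≢x))
  down : ∀ {x} → last ≢ x → Edge p x last
  down ≢x = inj₁ (≢fromℕ⇒< ≢x , lower ≢x)
  up : ∀ {x} → last ≢ x → Edge p last x
  up ≢x = inj₂ (≢fromℕ⇒< ≢x , lower ≢x)
  hub : ∀ {i j} → Dec (last ≡ i) → Dec (last ≡ j) → Edge p i j ⊎ (∃[ x ] Edge p i x × Edge p x j)
  hub (yes refl) (yes refl) = inj₂ (0F , up (λ ()) , down (λ ()))
  hub (yes refl) (no ≢j)    = inj₁ (up ≢j)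
  hub (no ≢i)    (yes refl) = inj₁ (down ≢i)
  hub (no ≢i)    (no ≢j)    = inj₂ (last , down ≢i , up ≢j)

Rigid⇒edge : ∀ {p : Fin k → ℕ} → 0 ℕ.< k → Rigid p → ∃[ i ] ∃[ j ] i < j × p j ℕ.< p i
Rigid⇒edge {k = suc k} _ rigid with rigid 0F 0F
... | inj₁ (inj₁ (a , b))              = _ , _ , a , b
... | inj₁ (inj₂ (a , b))              = _ , _ , a , b
... | inj₂ (_ , inj₁ (a , b) , _)      = _ , _ , a , b
... | inj₂ (_ , inj₂ (a , b) , _)      = _ , _ , a , b

module _ {g : Fin n → ℕ} {g⁺ : Fin (suc n) → ℕ} (S : Stretch g g⁺) where
  open Stretch S

  rigid-unstretch : ∀ {p : Fin k → ℕ} → Rigid p → Occ p g⁺ → Occ p g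
  rigid-unstretch rigid o = proj₁ (avoiding-c S o (rigid-avoids-c S rigid o))

  right⇒≥ : ∀ {i j} → punchIn c i ≡ j → c < j → toℕ c ℕ.≤ toℕ i
  right⇒≥ eq c<j = punchIn->⇒≥ c (subst (c <_) (sym eq) c<j)

  left⇒< : ∀ {i j} → punchIn c i ≡ j → j < c → toℕ i ℕ.< toℕ c
  left⇒< eq j<c = punchIn-<⇒< c (subst (_< c) (sym eq) j<c)

  lowest : ∃[ x ] toℕ {n} x ℕ.< toℕ c
  lowest = fromℕ< 0<n , subst (ℕ._< toℕ c) (sym (Fin.toℕ-fromℕ< 0<n)) left≢∅
    where
    0<n = ℕ.<-trans left≢∅ right≢∅

  highest : ∃[ x ] toℕ c ℕ.≤ toℕ {n} x
  highest = fromℕ< right≢∅ , ℕ.≤-reflexive (sym (Fin.toℕ-fromℕ< right≢∅))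

  -- Any entry of the left block lies before and below the whole right block and can play the
  -- smallest first entry.
  prepend-low : ∀ {p : Fin (suc k) → ℕ} → (∀ i → p 0F ℕ.< p (suc i)) →
                (o : Occ (p ∘ suc) g) → (∀ i → toℕ c ℕ.≤ toℕ (at o i)) → Occ p g
  prepend-low p₀-min o right = prepend o (proj₁ lowest)
    (λ i → ℕ.<-≤-trans (proj₂ lowest) (right i))
    (λ i lt → contradiction lt (ℕ.<-asym (p₀-min i)))
    (λ i _ → cut (proj₂ lowest) (right i))

  low-right : ∀ {p : Fin (suc k) → ℕ} → Low p → (o : Occ (p ∘ suc) g⁺) →
              (∀ i → c < at o i) → Occ p g
  low-right (_ , p₀-min , rigid) o right with avoiding-c S o (rigid-avoids-c S rigid o)
  ... | o′ , eq = prepend-low p₀-min o′ λ i → right⇒≥ (eq i) (right i)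

  -- With the connected part on the right, the first entry of the occurrence may be the inserted
  -- one; it is discarded and replaced from the left block. With the part on the left, the first
  -- entry is there too and nothing changes.
  low-unstretch : ∀ {p : Fin (suc k) → ℕ} → Low p → Occ p g⁺ → Occ p g
  low-unstretch {k = suc k} low@(0<k , p₀-min , rigid) o
    with rigid-sides S 0<k rigid (restrict 0F o)
  ... | inj₂ right = low-right low (restrict 0F o) right
  ... | inj₁ left  = proj₁ (avoiding-c S o λ where
    0F      eq → ℕ.<-irrefl (cong toℕ (sym eq)) (ℕ.<-trans (mono o (ℕ.s≤s ℕ.z≤n)) (left 0F))
    (suc i) eq → ℕ.<-irrefl (cong toℕ (sym eq)) (left i))

  high-unstretch : ∀ {p : Fin (suc k) → ℕ} → High p → Occ p g⁺ → Occ p g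
  high-unstretch {k = suc k} (0<k , p-max , rigid) o
    with rigid-sides S 0<k rigid (restrict (fromℕ (suc k)) o)
  ... | inj₁ left = append p-max o′ (proj₁ highest)
      (λ i → ℕ.<-≤-trans (left′ i) (proj₂ highest)) (λ i → cut (left′ i) (proj₂ highest))
    where
    init = restrict (fromℕ (suc k)) o
    avoiding = avoiding-c S init (rigid-avoids-c S rigid init)
    o′ = proj₁ avoiding
    left′ : ∀ i → toℕ (at o′ i) ℕ.< toℕ c
    left′ i = left⇒< (proj₂ avoiding i) (left i)
  ... | inj₂ right = proj₁ (avoiding-c S o λ i eq → ℕ.<-irrefl (cong toℕ eq) (all-right i))
    where
    all-right : ∀ i → c < at o i
    all-right i with fromℕ (suc k) ≟ i
    ... | yes refl = ℕ.<-trans (right 0F) (mono o (ℕ.≤∧≢⇒< (Fin.≤fromℕ _)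
                       (Fin.punchInᵢ≢i (fromℕ (suc k)) 0F ∘ toℕ-injective)))
    ... | no r≢i   = subst (λ j → c < at o j) (Fin.punchIn-punchOut r≢i) (right (punchOut r≢i))

-- The first entry is above the left part and the inserted entry, but may be
-- below more of the right part in f⁺ than in f.
record Case₁ (f : Fin (suc n) → ℕ) (f⁺ : Fin (suc (suc n)) → ℕ) : Set where
  field
    stretch : Stretch (f ∘ suc) (f⁺ ∘ suc)
  open Stretch stretch public
  field
    above-left  : ∀ {i} → toℕ i ℕ.< toℕ c → f (suc i) ℕ.< f 0F
    above-left⁺ : ∀ {j} → j ≤ c → f⁺ (suc j) ℕ.< f⁺ 0F
    drop        : ∀ {i} → f⁺ (suc (punchIn c i)) ℕ.< f⁺ 0F → f (suc i) ℕ.< f 0F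

module _ {f : Fin (suc n) → ℕ} {f⁺ : Fin (suc (suc n)) → ℕ} (C : Case₁ f f⁺) where
  open Case₁ C

  above⇒right : ∀ {j} → f⁺ 0F ℕ.< f⁺ (suc j) → c < j
  above⇒right lt = ℕ.≰⇒> λ j≤c → ℕ.<-asym lt (above-left⁺ j≤c)

  uses-first? : ∀ {p : Fin (suc k) → ℕ} (o : Occ p f⁺) → at o 0F ≡ 0F ⊎ (∀ i → 0 ℕ.< toℕ (at o i))
  uses-first? o with at o 0F in eq
  ... | 0F    = inj₁ refl
  ... | suc x = inj₂ λ where
    0F      → subst (λ y → 0 ℕ.< toℕ y) (sym eq) (ℕ.s≤s ℕ.z≤n)
    (suc i) → ℕ.≤-<-trans ℕ.z≤n (mono o {0F} {suc i} (ℕ.s≤s ℕ.z≤n))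

  tail : ∀ {p : Fin (suc k) → ℕ} (o : Occ p f⁺) →
         Σ[ o′ ∈ Occ (p ∘ suc) (f⁺ ∘ suc) ] (∀ i → suc (at o′ i) ≡ at o (suc i))
  tail o = earlier (restrict 0F o) λ i → ℕ.≤-<-trans ℕ.z≤n (mono o {0F} {suc i} (ℕ.s≤s ℕ.z≤n))

  -- An occurrence that skips the first entry of `f⁺` lies in the stretched tail. One that uses it
  -- is left to the caller, with its other entries in the tail and both comparisons to the first
  -- entry at hand.
  by-first : ∀ {p : Fin (suc k) → ℕ} →
    (∀ {m} {g : Fin m → ℕ} {g⁺} → Stretch g g⁺ → Occ p g⁺ → Occ p g) →
    ((o : Occ (p ∘ suc) (f⁺ ∘ suc)) →
     (∀ {i} → p 0F ℕ.< p (suc i) → f⁺ 0F ℕ.< f⁺ (suc (at o i))) →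
     (∀ {i} → p (suc i) ℕ.< p 0F → f⁺ (suc (at o i)) ℕ.< f⁺ 0F) → Occ p f) →
    Occ p f⁺ → Occ p f
  by-first unstretch-p with-first o with uses-first? o
  ... | inj₂ pos = later (unstretch-p stretch (proj₁ (earlier o pos)))
  ... | inj₁ eq  = with-first (proj₁ (tail o))
    (λ {i} lt → subst₂ (ℕ._<_ on f⁺) eq (sym (proj₂ (tail o) i)) (ordered o lt))
    (λ {i} lt → subst₂ (ℕ._<_ on f⁺) (sym (proj₂ (tail o) i)) eq (ordered o lt))

  -- If the first entry is used, the others exceed it and so lie in the right block. In `f` it may
  -- fail to be below them, hence its replacement by an entry of the left block.
  low-case₁ : ∀ {p : Fin (suc k) → ℕ} → Low p → Occ p f⁺ → Occ p f
  low-case₁ low@(_ , p₀-min , _) = by-first (λ S → low-unstretch S low) λ o above _ →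
    later (low-right stretch low o λ i → above⇒right (above (p₀-min i)))

  prepend-high : ∀ {p : Fin (suc k) → ℕ} → (∀ i → p (suc i) ℕ.< p 0F) →
                 (o : Occ (p ∘ suc) (f ∘ suc)) → (∀ i → f (suc (at o i)) ℕ.< f 0F) → Occ p f
  prepend-high p₀-max o below = prepend (later o) 0F (λ _ → ℕ.s≤s ℕ.z≤n)
    (λ i _ → below i) (λ i lt → contradiction lt (ℕ.<-asym (p₀-max i)))

  ends-case₁ : ∀ {p : Fin (suc (suc k)) → ℕ} → Ends p → Occ p f⁺ → Occ p f
  -- For 21 the tail is a single entry, which is not rigid; but the first entry and any entry of the
  -- left block form a 21.
  ends-case₁ {k = zero} {p} (p₀-max , _) _ =
    prepend-high p₀-max
      (occ (λ _ → proj₁ (lowest stretch)) (λ { {0F} {0F} () })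
           (λ { {0F} {0F} lt → contradiction lt (ℕ.<-irrefl refl) }))
      λ _ → above-left (proj₂ (lowest stretch))
  ends-case₁ {k = suc k} {p} (p₀-max , p-min) =
    by-first (λ S → rigid-unstretch S (maxFirst⇒Rigid p₀-max)) λ o _ below →
      -- As a maximum, the first entry only has to stay above the others, which is the comparison
      -- that `drop` transfers.
      let o′ , eq = avoiding-c stretch o (rigid-avoids-c stretch (minLast⇒Rigid (p-min ∘ suc)) o) in
      prepend-high p₀-max o′ λ i → drop
        (subst (λ j → f⁺ (suc j) ℕ.< f⁺ 0F) (sym (eq i)) (below (p₀-max i)))

  blocked-case₁ : ∀ {p : Fin (suc k) → ℕ} → High p → Blocked p → Occ p f⁺ → Occ p f
  blocked-case₁ {k = suc k} high (suc i , suc j , _ , i<j , j<l , p₀<pᵢ , pⱼ<pᵢ , pᵢ<pₗ) =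
    by-first (λ S → high-unstretch S high) λ o above _ → contradiction (ordered o pᵢ<pₗ)
      (avoids213 (above⇒right (above p₀<pᵢ)) (mono o (ℕ.s<s⁻¹ i<j))
                 (mono o (ℕ.s<s⁻¹ j<l)) (ordered o pⱼ<pᵢ))

  -- When the first entry is used, a connected part in the right block would form a 213 there with
  -- the last entry. So the part lies in the left block, below the first entry of `f`, and `u`
  -- replaces the last entry.
  capped-case₁ : (∃[ u ] f 0F ℕ.< f (suc u)) →
                 ∀ {p : Fin (suc (suc k)) → ℕ} → High p → Capped p → Occ p f⁺ → Occ p f
  capped-case₁ {k = k} (u , f₀<fᵤ) {p} high@(_ , p-max , _) (p₀-max , 0<k , p-max′ , rigid) =
    by-first (λ S → high-unstretch S high) with-first
    where
    last = fromℕ k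

    with-first : (o : Occ (p ∘ suc) (f⁺ ∘ suc)) →
      (∀ {i} → p 0F ℕ.< p (suc i) → f⁺ 0F ℕ.< f⁺ (suc (at o i))) →
      (∀ {i} → p (suc i) ℕ.< p 0F → f⁺ (suc (at o i)) ℕ.< f⁺ 0F) → Occ p f
    with-first o above _ with rigid-sides stretch 0<k rigid (restrict last o)
    ... | inj₂ right =
      let i , j , i<j , inv = Rigid⇒edge 0<k rigid in
      contradiction (ordered o (p-max′ i))
        (avoids213 (right i) (mono o (punchIn-mono-< last i<j))
                   (mono o (≢fromℕ⇒< (Fin.punchInᵢ≢i last j ∘ sym))) (ordered o inv))
    ... | inj₁ left =
      append p-max (prepend-high p₀-max o′ (above-left ∘ left′)) (suc u)
        (λ { 0F → ℕ.s≤s ℕ.z≤n ; (suc i) → ℕ.s≤s (ℕ.<-≤-trans (left′ i) c≤u) })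
        (λ { 0F → f₀<fᵤ ; (suc i) → cut (left′ i) c≤u })
      where
      avoiding = avoiding-c stretch (restrict last o) (rigid-avoids-c stretch rigid (restrict last o))
      o′ = proj₁ avoiding
      left′ : ∀ i → toℕ (at o′ i) ℕ.< toℕ c
      left′ i = left⇒< stretch (proj₂ avoiding i) (left i)
      c≤u : toℕ c ℕ.≤ toℕ u
      c≤u = ℕ.≮⇒≥ λ u<c → ℕ.<-asym f₀<fᵤ (above-left u<c)

-- Cuts and insertions in permutations

tabulate-injective : ∀ {A : Set} {f g : Fin n → A} → tabulate f ≡ tabulate g → f ≗ g
tabulate-injective eq zero    = List.∷-injectiveˡ eq
tabulate-injective eq (suc i) = tabulate-injective (List.∷-injectiveʳ eq) i

≋⇒length≡ : (π : Permutation′ m) (ρ : Permutation′ n) → π ≋ ρ → m ≡ n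
≋⇒length≡ π ρ eq = trans (sym (List.length-tabulate _)) (trans (cong length eq) (List.length-tabulate _))

≋⇒≈ : (π ρ : Permutation′ n) → π ≋ ρ → π ≈ ρ
≋⇒≈ π ρ eq i = toℕ-injective (ℕ.suc-injective (tabulate-injective eq i))

≈⇒≋ : (π ρ : Permutation′ n) → π ≈ ρ → π ≋ ρ
≈⇒≋ _ _ eq = List.tabulate-cong (cong (suc ∘ toℕ) ∘ eq)

≋⇒val : (π : Permutation′ m) (ρ : Permutation′ n) → π ≋ ρ →
        ∀ {i j} → toℕ i ≡ toℕ j → val π i ≡ val ρ j
≋⇒val π ρ eq i≡j with refl ← ≋⇒length≡ π ρ eq with refl ← toℕ-injective i≡j =
  cong toℕ (≋⇒≈ π ρ eq _)

data SplitView (a : ℕ) {b} : Fin (a + b) → Set where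
  left  : ∀ i → SplitView a (i ↑ˡ b)
  right : ∀ j → SplitView a (a ↑ʳ j)

splitView : ∀ a {b} (i : Fin (a + b)) → SplitView a i
splitView a i with splitAt a i in eq
... | inj₁ j = subst (SplitView a) (Fin.splitAt⁻¹-↑ˡ eq) (left j)
... | inj₂ j = subst (SplitView a) (Fin.splitAt⁻¹-↑ʳ eq) (right j)

⊕-left : (σ : Permutation′ a) (τ : Permutation′ b) → ∀ i → (σ ⊕ τ) ⟨$⟩ʳ (i ↑ˡ b) ≡ (σ ⟨$⟩ʳ i) ↑ˡ b
⊕-left {a} {b} σ τ i rewrite Fin.splitAt-↑ˡ a i b = refl

⊕-right : (σ : Permutation′ a) (τ : Permutation′ b) → ∀ j → (σ ⊕ τ) ⟨$⟩ʳ (a ↑ʳ j) ≡ a ↑ʳ (τ ⟨$⟩ʳ j)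
⊕-right {a} {b} σ τ j rewrite Fin.splitAt-↑ʳ a b j = refl

val-⊕-left : (σ : Permutation′ a) (τ : Permutation′ b) → ∀ i → val (σ ⊕ τ) (i ↑ˡ b) ≡ val σ i
val-⊕-left σ τ i = trans (cong toℕ (⊕-left σ τ i)) (Fin.toℕ-↑ˡ _ _)

val-⊕-right : (σ : Permutation′ a) (τ : Permutation′ b) → ∀ j → val (σ ⊕ τ) (a ↑ʳ j) ≡ a + val τ j
val-⊕-right {a} σ τ j = trans (cong toℕ (⊕-right σ τ j)) (Fin.toℕ-↑ʳ a _)

↑ˡ-< : (i : Fin a) → toℕ (i ↑ˡ b) ℕ.< a
↑ˡ-< {b = b} i = subst (ℕ._< _) (sym (Fin.toℕ-↑ˡ i b)) (Fin.toℕ<n i)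

↑ʳ-≥ : (j : Fin b) → a ℕ.≤ toℕ (a ↑ʳ j)
↑ʳ-≥ {a = a} j = subst (a ℕ.≤_) (sym (Fin.toℕ-↑ʳ a j)) (ℕ.m≤m+n a _)

-- Decomposability without naming the summands. In this form it is decided by trying all sizes and
-- passes easily to inverses and reverse-complements.
record Cut (π : Permutation′ n) : Set where
  constructor mkCut
  field
    size  : ℕ
    0<    : 0 ℕ.< size
    <n    : size ℕ.< n
    below : ∀ i → toℕ i ℕ.< size → val π i ℕ.< size
    above : ∀ i → size ℕ.≤ toℕ i → size ℕ.≤ val π i

cut-≈ : {π ρ : Permutation′ n} → π ≈ ρ → Cut π → Cut ρ
cut-≈ eq (mkCut s 0< <n below above) = mkCut s 0< <n
  (λ i lt → subst (λ x → toℕ x ℕ.< s) (eq i) (below i lt))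
  (λ i le → subst (λ x → s ℕ.≤ toℕ x) (eq i) (above i le))

⊕-cut : (σ : Permutation′ (suc a)) (τ : Permutation′ (suc b)) → Cut (σ ⊕ τ)
⊕-cut {a} {b} σ τ = mkCut (suc a) (ℕ.s≤s ℕ.z≤n) (ℕ.m<m+n (suc a) (ℕ.s≤s ℕ.z≤n)) below above
  where
  below : ∀ i → toℕ i ℕ.< suc a → val (σ ⊕ τ) i ℕ.< suc a
  below i lt with splitView (suc a) i
  ... | left i′  = subst (ℕ._< suc a) (sym (val-⊕-left σ τ i′)) (Fin.toℕ<n _)
  ... | right j = contradiction lt (ℕ.≤⇒≯ (↑ʳ-≥ j))
  above : ∀ i → suc a ℕ.≤ toℕ i → suc a ℕ.≤ val (σ ⊕ τ) i
  above i le with splitView (suc a) i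
  ... | left i′ = contradiction le (ℕ.<⇒≱ (↑ˡ-< i′))
  ... | right j = subst (suc a ℕ.≤_) (sym (val-⊕-right σ τ j)) (ℕ.m≤m+n (suc a) _)

decomposable⇒cut : (π : Permutation′ n) → Decomposable π → Cut π
decomposable⇒cut π (a , b , σ , τ , eq) with refl ← ≋⇒length≡ π (σ ⊕ τ) eq =
  cut-≈ (sym ∘ ≋⇒≈ π (σ ⊕ τ) eq) (⊕-cut σ τ)

-- Since π and its inverse both preserve the image of ι, they restrict to it; this yields the two
-- summands at a cut.
module _ (π : Permutation′ n) (ι : Fin k → Fin n) (ι-injective : ∀ {i j} → ι i ≡ ι j → i ≡ j)
         (to : ∀ i → Σ[ j ∈ Fin k ] π ⟨$⟩ʳ ι i ≡ ι j)
         (from : ∀ i → Σ[ j ∈ Fin k ] π ⟨$⟩ˡ ι i ≡ ι j) where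

  along : Permutation′ k
  along = permutation (proj₁ ∘ to) (proj₁ ∘ from)
    (λ i → ι-injective (trans (sym (proj₂ (to _)))
      (trans (cong (π ⟨$⟩ʳ_) (sym (proj₂ (from i)))) (inverseʳ π))))
    (λ i → ι-injective (trans (sym (proj₂ (from _)))
      (trans (cong (π ⟨$⟩ˡ_) (sym (proj₂ (to i)))) (inverseˡ π))))

-- If the preimage of a small value were beyond the cut, `above` would make the value large; `below`
-- settles the converse.
cut-flip : {π : Permutation′ n} → Cut π → Cut (flip π)
cut-flip {π = π} (mkCut s 0< <n below above) = mkCut s 0< <n
  (λ i lt → ℕ.≰⇒> λ le → ℕ.<⇒≱ lt (subst (λ x → s ℕ.≤ toℕ x) (inverseʳ π) (above (π ⟨$⟩ˡ i) le)))
  (λ i le → ℕ.≮⇒≥ λ lt → ℕ.≤⇒≯ le (subst (λ x → toℕ x ℕ.< s) (inverseʳ π) (below (π ⟨$⟩ˡ i) lt)))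

cut⇒⊕ : ∀ a {b} (π : Permutation′ (a + b)) →
        (∀ i → toℕ i ℕ.< a → val π i ℕ.< a) → (∀ i → a ℕ.≤ toℕ i → a ℕ.≤ val π i) →
        (∀ i → toℕ i ℕ.< a → val (flip π) i ℕ.< a) → (∀ i → a ℕ.≤ toℕ i → a ℕ.≤ val (flip π) i) →
        Σ[ σ ∈ Permutation′ a ] Σ[ τ ∈ Permutation′ b ] π ≈ (σ ⊕ τ)
cut⇒⊕ a {b} π below above below⁻ above⁻ = σ , τ , eq
  where
  toLeft : ∀ {i} → toℕ i ℕ.< a → Σ[ j ∈ Fin a ] i ≡ j ↑ˡ b
  toLeft {i} lt with splitView a i
  ... | left j  = j , refl
  ... | right j = contradiction lt (ℕ.≤⇒≯ (↑ʳ-≥ j))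
  toRight : ∀ {i} → a ℕ.≤ toℕ i → Σ[ j ∈ Fin b ] i ≡ a ↑ʳ j
  toRight {i} le with splitView a i
  ... | left j  = contradiction le (ℕ.<⇒≱ (↑ˡ-< j))
  ... | right j = j , refl
  σ-to   = λ i → toLeft (below (i ↑ˡ b) (↑ˡ-< i))
  σ-from = λ i → toLeft (below⁻ (i ↑ˡ b) (↑ˡ-< i))
  τ-to   = λ j → toRight (above (a ↑ʳ j) (↑ʳ-≥ j))
  τ-from = λ j → toRight (above⁻ (a ↑ʳ j) (↑ʳ-≥ j))
  σ = along π (_↑ˡ b) (Fin.↑ˡ-injective b _ _) σ-to σ-from
  τ = along π (a ↑ʳ_) (Fin.↑ʳ-injective a _ _) τ-to τ-from
  eq : π ≈ (σ ⊕ τ)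
  eq i with splitView a i
  ... | left j  = trans (proj₂ (σ-to j)) (sym (⊕-left σ τ j))
  ... | right j = trans (proj₂ (τ-to j)) (sym (⊕-right σ τ j))

cut⇒decomposable : (π : Permutation′ n) → Cut π → Decomposable π
cut⇒decomposable π cut@(mkCut (suc a) 0< <n below above)
  with b , eq ← ℕ.m≤n⇒∃[o]m+o≡n <n
  with refl ← trans (ℕ.+-suc (suc a) b) eq =
  let mkCut _ _ _ below⁻ above⁻ = cut-flip {π = π} cut
      σ , τ , π≈ = cut⇒⊕ (suc a) π below above below⁻ above⁻
  in a , b , σ , τ , ≈⇒≋ π (σ ⊕ τ) π≈

-- Decomposability under inverses and reverse-complements

opposite-sum : ∀ (i : Fin n) → toℕ (opposite i) + suc (toℕ i) ≡ n
opposite-sum i = trans (cong (_+ suc (toℕ i)) (Fin.opposite-prop i)) (ℕ.m∸n+n≡m (Fin.toℕ<n i))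

-- `opposite` is handled through its sum with the argument instead of truncated subtraction; its
-- order reversal comes from comparing two equal sums.
balance : ∀ {x y u v} → x + y ≡ u + v → v ℕ.≤ y → x ℕ.≤ u
balance {x} {y} {u} {v} eq v≤y = ℕ.+-cancelʳ-≤ v x u
  (ℕ.≤-trans (ℕ.+-monoʳ-≤ x v≤y) (ℕ.≤-reflexive eq))

cut-rc : {π : Permutation′ n} → Cut π → Cut (rc π)
cut-rc {n} {π} (mkCut s 0< <n below above) = mkCut t (ℕ.m<n⇒0<n∸m <n) (ℕ.∸-monoʳ-< 0< (ℕ.<⇒≤ <n))
  (λ i lt → opposite-< (above _ (opposite-≥ lt)))
  (λ i le → opposite-≥′ (below _ (opposite-<′ le)))
  where
  t = n ℕ.∸ s
  t+s : t + s ≡ n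
  t+s = ℕ.m∸n+n≡m (ℕ.<⇒≤ <n)
  s+t : s + t ≡ n
  s+t = trans (ℕ.+-comm s t) t+s
  opposite-sum′ : ∀ (i : Fin n) → suc (toℕ (opposite i)) + toℕ i ≡ n
  opposite-sum′ i = trans (sym (ℕ.+-suc _ _)) (opposite-sum i)
  opposite-≥ : ∀ {i : Fin n} → toℕ i ℕ.< t → s ℕ.≤ toℕ (opposite i)
  opposite-≥ {i} = balance (trans s+t (sym (opposite-sum i)))
  opposite-≥′ : ∀ {i : Fin n} → toℕ i ℕ.< s → t ℕ.≤ toℕ (opposite i)
  opposite-≥′ {i} = balance (trans t+s (sym (opposite-sum i)))
  opposite-< : ∀ {i : Fin n} → s ℕ.≤ toℕ i → toℕ (opposite i) ℕ.< t
  opposite-< {i} = balance (trans (opposite-sum′ i) (sym t+s))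
  opposite-<′ : ∀ {i : Fin n} → t ℕ.≤ toℕ i → toℕ (opposite i) ℕ.< s
  opposite-<′ {i} = balance (trans (opposite-sum′ i) (sym s+t))

≈-decomposable : (π ρ : Permutation′ n) → π ≈ ρ → Decomposable π → Decomposable ρ
≈-decomposable π ρ π≈ρ = cut⇒decomposable ρ ∘ cut-≈ π≈ρ ∘ decomposable⇒cut π

flip⁻-decomposable : (π : Permutation′ n) → Decomposable (flip π) → Decomposable π
flip⁻-decomposable π = cut⇒decomposable π ∘ cut-flip ∘ decomposable⇒cut (flip π)

rc-rc : (π : Permutation′ n) → rc (rc π) ≈ π
rc-rc π i = trans (Fin.opposite-involutive _) (cong (π ⟨$⟩ʳ_) (Fin.opposite-involutive i))

rc⁻-decomposable : (π : Permutation′ n) → Decomposable (rc π) → Decomposable π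
rc⁻-decomposable π = ≈-decomposable (rc (rc π)) π (rc-rc π)
  ∘ cut⇒decomposable (rc (rc π)) ∘ cut-rc ∘ decomposable⇒cut (rc π)

punchIn-opposite : ∀ (c : Fin (suc n)) i →
                   punchIn (opposite c) (opposite i) ≡ opposite (punchIn c i)
punchIn-opposite {n} c i with ℕ.<-≤-connex (toℕ i) (toℕ c)
... | inj₁ i<c = toℕ-injective (ℕ.+-cancelʳ-≡ (suc (toℕ i)) _ _ (begin
    toℕ (punchIn (opposite c) (opposite i)) + suc (toℕ i)
      ≡⟨ cong (_+ suc (toℕ i)) (toℕ-punchIn-≥ (opposite c) (opposite i) c≤i) ⟩
    suc (toℕ (opposite i) + suc (toℕ i))
      ≡⟨ cong suc (opposite-sum i) ⟩
    suc n
      ≡⟨ opposite-sum (punchIn c i) ⟨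
    toℕ (opposite (punchIn c i)) + suc (toℕ (punchIn c i))
      ≡⟨ cong (λ x → toℕ (opposite (punchIn c i)) + suc x) (toℕ-punchIn-< c i i<c) ⟩
    toℕ (opposite (punchIn c i)) + suc (toℕ i) ∎))
  where
  open ≡-Reasoning
  c≤i : opposite c ≤ opposite i
  c≤i = balance (trans (opposite-sum c) (sym (trans (ℕ.+-suc _ _) (cong suc (opposite-sum i)))))
                (ℕ.s≤s i<c)
... | inj₂ c≤i = toℕ-injective (ℕ.+-cancelʳ-≡ (suc (suc (toℕ i))) _ _ (begin
    toℕ (punchIn (opposite c) (opposite i)) + suc (suc (toℕ i))
      ≡⟨ cong (_+ suc (suc (toℕ i))) (toℕ-punchIn-< (opposite c) (opposite i) i<c) ⟩
    toℕ (opposite i) + suc (suc (toℕ i))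
      ≡⟨ trans (ℕ.+-suc _ _) (cong suc (opposite-sum i)) ⟩
    suc n
      ≡⟨ opposite-sum (punchIn c i) ⟨
    toℕ (opposite (punchIn c i)) + suc (toℕ (punchIn c i))
      ≡⟨ cong (λ x → toℕ (opposite (punchIn c i)) + suc x) (toℕ-punchIn-≥ c i c≤i) ⟩
    toℕ (opposite (punchIn c i)) + suc (suc (toℕ i)) ∎))
  where
  open ≡-Reasoning
  i<c : opposite i < opposite c
  i<c = balance (trans (cong suc (opposite-sum i)) (sym (opposite-sum c))) (ℕ.s≤s c≤i)

-- Checked after applying the injective `punchIn e`, where both sides become the position in π of
-- the value `punchIn (π ⟨$⟩ʳ e) i`.
remove-flip : (π : Permutation′ (suc n)) (e : Fin (suc n)) →
              remove (π ⟨$⟩ʳ e) (flip π) ≈ flip (remove e π)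
remove-flip π e i = Fin.punchIn-injective e _ _ (begin
  punchIn e (remove (π ⟨$⟩ʳ e) (flip π) ⟨$⟩ʳ i)
    ≡⟨ cong (λ x → punchIn x (remove (π ⟨$⟩ʳ e) (flip π) ⟨$⟩ʳ i)) (inverseˡ π) ⟨
  punchIn (π ⟨$⟩ˡ (π ⟨$⟩ʳ e)) (remove (π ⟨$⟩ʳ e) (flip π) ⟨$⟩ʳ i)
    ≡⟨ punchIn-permute (flip π) (π ⟨$⟩ʳ e) i ⟨
  π ⟨$⟩ˡ punchIn (π ⟨$⟩ʳ e) i
    ≡⟨ cong (λ x → π ⟨$⟩ˡ punchIn (π ⟨$⟩ʳ e) x) (inverseʳ (remove e π)) ⟨
  π ⟨$⟩ˡ punchIn (π ⟨$⟩ʳ e) (remove e π ⟨$⟩ʳ (remove e π ⟨$⟩ˡ i))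
    ≡⟨ cong (π ⟨$⟩ˡ_) (punchIn-permute π e _) ⟨
  π ⟨$⟩ˡ (π ⟨$⟩ʳ punchIn e (remove e π ⟨$⟩ˡ i))
    ≡⟨ inverseˡ π ⟩
  punchIn e (remove e π ⟨$⟩ˡ i) ∎)
  where open ≡-Reasoning

remove-rc : (π : Permutation′ (suc n)) (c : Fin (suc n)) →
            remove (opposite c) (rc π) ≈ rc (remove c π)
remove-rc π c i = Fin.punchIn-injective (opposite (π ⟨$⟩ʳ c)) _ _ (begin
  punchIn (opposite (π ⟨$⟩ʳ c)) (remove (opposite c) (rc π) ⟨$⟩ʳ i)
    ≡⟨ cong (λ x → punchIn (opposite (π ⟨$⟩ʳ x)) (remove (opposite c) (rc π) ⟨$⟩ʳ i))
            (Fin.opposite-involutive c) ⟨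
  punchIn (rc π ⟨$⟩ʳ opposite c) (remove (opposite c) (rc π) ⟨$⟩ʳ i)
    ≡⟨ punchIn-permute (rc π) (opposite c) i ⟨
  opposite (π ⟨$⟩ʳ opposite (punchIn (opposite c) i))
    ≡⟨ cong (λ x → opposite (π ⟨$⟩ʳ opposite (punchIn (opposite c) x))) (Fin.opposite-involutive i) ⟨
  opposite (π ⟨$⟩ʳ opposite (punchIn (opposite c) (opposite (opposite i))))
    ≡⟨ cong (λ x → opposite (π ⟨$⟩ʳ opposite x)) (punchIn-opposite c (opposite i)) ⟩
  opposite (π ⟨$⟩ʳ opposite (opposite (punchIn c (opposite i))))
    ≡⟨ cong (λ x → opposite (π ⟨$⟩ʳ x)) (Fin.opposite-involutive _) ⟩
  opposite (π ⟨$⟩ʳ punchIn c (opposite i))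
    ≡⟨ cong opposite (punchIn-permute π c (opposite i)) ⟩
  opposite (punchIn (π ⟨$⟩ʳ c) (remove c π ⟨$⟩ʳ opposite i))
    ≡⟨ punchIn-opposite (π ⟨$⟩ʳ c) _ ⟨
  punchIn (opposite (π ⟨$⟩ʳ c)) (rc (remove c π) ⟨$⟩ʳ i) ∎)
  where open ≡-Reasoning

-- Both deletions remove the same point (e, π(e)) of the diagram of π.
flip-∖ : (π : Permutation′ (suc n)) (e : Fin (suc n)) →
         Decomposable (flip π ∖ e) → Decomposable (π ∖ (π ⟨$⟩ʳ e))
flip-∖ π e = subst (λ x → Decomposable (remove x π)) (sym (inverseˡ π))
           ∘ flip⁻-decomposable (remove e π)
           ∘ ≈-decomposable (flip π ∖ e) (flip (remove e π)) (remove-flip π e)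

rc-∖ : (π : Permutation′ (suc n)) (e : Fin (suc n)) →
       Decomposable (rc π ∖ e) → Decomposable (π ∖ opposite e)
rc-∖ π e = rc⁻-decomposable (π ∖ opposite e)
         ∘ ≈-decomposable (rc π ∖ e) (rc (π ∖ opposite e)) (remove-rc π (π ⟨$⟩ˡ opposite e))

-- Enlarged sums as insertions of a fixed point

record Insertion (π : Permutation′ n) (ρ : Permutation′ (suc n)) : Set where
  field
    c         : Fin (suc n)
    left≢∅    : 0 ℕ.< toℕ c
    right≢∅   : toℕ c ℕ.< n
    below     : ∀ i → toℕ i ℕ.< toℕ c → val π i ℕ.< toℕ c
    above     : ∀ i → toℕ c ℕ.≤ toℕ i → toℕ c ℕ.≤ val π i
    at-c      : ρ ⟨$⟩ʳ c ≡ c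
    off-c     : ∀ i → ρ ⟨$⟩ʳ punchIn c i ≡ punchIn c (π ⟨$⟩ʳ i)
    avoids213 : ∀ {i j l} → c < i → i < j → j < l → val ρ j ℕ.< val ρ i → val ρ i ℕ.< val ρ l → ⊥

occ-[213] : (f : Fin n → ℕ) → ∀ {i j l} → i < j → j < l →
            f j ℕ.< f i → f i ℕ.< f l → Occ (val [213]) f
occ-[213] {n} f {i} {j} {l} i<j j<l fj<fi fi<fl = occ e e-mono e-ordered
  where
  e : Fin 3 → Fin n
  e 0F = i
  e 1F = j
  e 2F = l
  e-mono : ∀ {a b} → a < b → e a < e b
  e-mono {0F} {1F} _ = i<j
  e-mono {0F} {2F} _ = ℕ.<-trans i<j j<l
  e-mono {1F} {2F} _ = j<l
  e-mono {1F} {1F} (ℕ.s≤s ())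
  e-mono {2F} {1F} (ℕ.s≤s ())
  e-mono {2F} {2F} (ℕ.s≤s (ℕ.s≤s ()))
  e-ordered : ∀ {a b} → val [213] a ℕ.< val [213] b → f (e a) ℕ.< f (e b)
  e-ordered {0F} {2F} _ = fi<fl
  e-ordered {1F} {0F} _ = fj<fi
  e-ordered {1F} {2F} _ = ℕ.<-trans fj<fi fi<fl
  e-ordered {0F} {0F} (ℕ.s≤s ())
  e-ordered {2F} {0F} (ℕ.s≤s ())
  e-ordered {2F} {2F} (ℕ.s≤s (ℕ.s≤s ()))

val-id-⊕ : (τ : Permutation′ b) → ∀ i → toℕ i ℕ.< m → val (id {m} ⊕ τ) i ≡ toℕ i
val-id-⊕ {m = m} τ i i<m with splitView m i
... | left i′ = trans (val-⊕-left (id {m}) τ i′) (sym (Fin.toℕ-↑ˡ i′ _))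
... | right j = contradiction i<m (ℕ.≤⇒≯ (↑ʳ-≥ j))

val-id-suc : (τ : Permutation′ b) → ∀ i → val (id {suc m} ⊕ τ) (suc i) ≡ suc (val (id {m} ⊕ τ) i)
val-id-suc {b} {m} τ i with splitView m i
... | left i′ = trans (val-⊕-left (id {suc m}) τ (suc i′))
                       (cong suc (sym (val-⊕-left (id {m}) τ i′)))
... | right j = trans (val-⊕-right (id {suc m}) τ j) (cong suc (sym (val-⊕-right (id {m}) τ j)))

-- Entries of the identity part belong to no inversion, so the 2 and the 1 lie in τ, and then so
-- does the 3.
id-⊕-avoids213 : (τ : Permutation′ b) → Avoids τ [213] → ∀ {i j l} → i < j → j < l →
  val (id {m} ⊕ τ) j ℕ.< val (id {m} ⊕ τ) i → val (id {m} ⊕ τ) i ℕ.< val (id {m} ⊕ τ) l → ⊥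
id-⊕-avoids213 {m = m} τ av {i} {j} {l} i<j j<l lt lt′
  with splitView m i | splitView m j | splitView m l
... | right i′ | right j′ | right l′ =
  av (occ⇒contains {π = τ} {[213]} (occ-[213] (val τ) (shift i<j) (shift j<l)
    (shift-val lt) (shift-val lt′)))
  where
  shift : ∀ {x y : Fin _} → (m ↑ʳ x) < (m ↑ʳ y) → x < y
  shift {x} {y} = ℕ.+-cancelˡ-< m _ _ ∘ subst₂ ℕ._<_ (Fin.toℕ-↑ʳ m x) (Fin.toℕ-↑ʳ m y)
  shift-val : ∀ {x y} → val (id {m} ⊕ τ) (m ↑ʳ x) ℕ.< val (id {m} ⊕ τ) (m ↑ʳ y) →
              val τ x ℕ.< val τ y
  shift-val {x} {y} = ℕ.+-cancelˡ-< m _ _ ∘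
    subst₂ ℕ._<_ (val-⊕-right (id {m}) τ x) (val-⊕-right (id {m}) τ y)
... | right i′ | right j′ | left l′ = contradiction (ℕ.<-trans i<j j<l)
      (ℕ.<⇒≯ (ℕ.<-≤-trans (↑ˡ-< l′) (↑ʳ-≥ i′)))
... | right i′ | left j′ | _ = contradiction i<j (ℕ.<⇒≯ (ℕ.<-≤-trans (↑ˡ-< j′) (↑ʳ-≥ i′)))
... | left i′ | right j′ | _ = contradiction lt (ℕ.<⇒≯ (ℕ.<-≤-trans
      (subst (ℕ._< m) (sym (val-⊕-left (id {m}) τ i′)) (Fin.toℕ<n i′))
      (subst (m ℕ.≤_) (sym (val-⊕-right (id {m}) τ j′)) (ℕ.m≤m+n m _))))
... | left i′ | left j′ | _ = contradiction
      (subst₂ ℕ._<_ (val-id-⊕ τ _ (↑ˡ-< j′)) (val-id-⊕ τ _ (↑ˡ-< i′)) lt) (ℕ.<-asym i<j)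

-- Of the m + 1 fixed points in the middle, the one directly after σ counts as inserted. The right
-- block is then the old identity together with τ, which avoids 213.
f̃⇒insertion : {π : Permutation′ n} {ρ : Permutation′ (suc n)} → π f̃↦ ρ → Insertion π ρ
f̃⇒insertion {π = π} {ρ} (enlarge {a} {b} m σ τ _ _ _ τ-avoids π≋ ρ≋)
  with refl ← ≋⇒length≡ π (σ ⊕ (id {m} ⊕ τ)) π≋ = record
    { c         = c
    ; left≢∅    = subst (0 ℕ.<_) (sym c≡a) (ℕ.s≤s ℕ.z≤n)
    ; right≢∅   = subst (ℕ._< suc a + (m + suc b)) (sym c≡a)
                    (ℕ.m<m+n (suc a) (ℕ.<-≤-trans (ℕ.s≤s ℕ.z≤n) (ℕ.m≤n+m (suc b) m)))
    ; below     = λ i lt → subst (val π i ℕ.<_) (sym c≡a) (below i (subst (toℕ i ℕ.<_) c≡a lt))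
    ; above     = λ i le → subst (ℕ._≤ val π i) (sym c≡a) (above i (subst (ℕ._≤ toℕ i) c≡a le))
    ; at-c      = toℕ-injective (trans (ρ-right {c} {0F} (trans c≡a (sym (ℕ.+-identityʳ _))))
                    (trans (ℕ.+-identityʳ _) (sym c≡a)))
    ; off-c     = off
    ; avoids213 = λ {i} {j} {l} c<i i<j j<l → avoids (position c<i) (position (ℕ.<-trans c<i i<j))
                    (position (ℕ.<-trans c<i (ℕ.<-trans i<j j<l))) i<j j<l
    }
  where
  N = m + suc b
  T  = id {m} ⊕ τ
  T⁺ = id {suc m} ⊕ τ
  c : Fin (suc (suc a + N))
  c = fromℕ< {suc a} (ℕ.s≤s (ℕ.m≤m+n (suc a) N))
  c≡a : toℕ c ≡ suc a
  c≡a = Fin.toℕ-fromℕ< (ℕ.s≤s (ℕ.m≤m+n (suc a) N))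

  ρ-left : ∀ {i} {i′ : Fin (suc a)} → toℕ i ≡ toℕ i′ → val ρ i ≡ val σ i′
  ρ-left {i} {i′} eq = trans
    (≋⇒val ρ (σ ⊕ T⁺) ρ≋ (trans eq (sym (Fin.toℕ-↑ˡ i′ (suc N))))) (val-⊕-left σ T⁺ i′)

  ρ-right : ∀ {i} {j : Fin (suc N)} → toℕ i ≡ suc a + toℕ j → val ρ i ≡ suc a + val T⁺ j
  ρ-right {i} {j} eq = trans
    (≋⇒val ρ (σ ⊕ T⁺) ρ≋ (trans eq (sym (Fin.toℕ-↑ʳ (suc a) j)))) (val-⊕-right σ T⁺ j)

  π-left : ∀ i → val π (i ↑ˡ N) ≡ val σ i
  π-left i = trans (≋⇒val π (σ ⊕ T) π≋ refl) (val-⊕-left σ T i)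

  π-right : ∀ j → val π (suc a ↑ʳ j) ≡ suc a + val T j
  π-right j = trans (≋⇒val π (σ ⊕ T) π≋ refl) (val-⊕-right σ T j)

  below : ∀ i → toℕ i ℕ.< suc a → val π i ℕ.< suc a
  below i lt with splitView (suc a) i
  ... | left i′ = subst (ℕ._< suc a) (sym (π-left i′)) (Fin.toℕ<n _)
  ... | right j = contradiction lt (ℕ.≤⇒≯ (↑ʳ-≥ j))

  above : ∀ i → suc a ℕ.≤ toℕ i → suc a ℕ.≤ val π i
  above i le with splitView (suc a) i
  ... | left i′ = contradiction le (ℕ.<⇒≱ (↑ˡ-< i′))
  ... | right j = subst (suc a ℕ.≤_) (sym (π-right j)) (ℕ.m≤m+n (suc a) _)

  off : ∀ i → ρ ⟨$⟩ʳ punchIn c i ≡ punchIn c (π ⟨$⟩ʳ i)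
  off i with splitView (suc a) i
  ... | left i′ = toℕ-injective (begin
    val ρ (punchIn c (i′ ↑ˡ N))
      ≡⟨ ρ-left (trans (toℕ-punchIn-< c _ (<c (↑ˡ-< i′))) (Fin.toℕ-↑ˡ i′ N)) ⟩
    val σ i′
      ≡⟨ π-left i′ ⟨
    val π (i′ ↑ˡ N)
      ≡⟨ toℕ-punchIn-< c _ (<c (below _ (↑ˡ-< i′))) ⟨
    toℕ (punchIn c (π ⟨$⟩ʳ (i′ ↑ˡ N))) ∎)
    where
    open ≡-Reasoning
    <c : ∀ {x} → x ℕ.< suc a → x ℕ.< toℕ c
    <c {x} = subst (x ℕ.<_) (sym c≡a)
  ... | right j = toℕ-injective (begin
    val ρ (punchIn c (suc a ↑ʳ j))
      ≡⟨ ρ-right {j = suc j} (trans (toℕ-punchIn-≥ c _ (c≤ (↑ʳ-≥ j)))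
           (trans (cong suc (Fin.toℕ-↑ʳ (suc a) j)) (sym (ℕ.+-suc (suc a) _)))) ⟩
    suc a + val T⁺ (suc j)
      ≡⟨ cong (suc a +_) (val-id-suc {m = m} τ j) ⟩
    suc a + suc (val T j)
      ≡⟨ ℕ.+-suc (suc a) _ ⟩
    suc (suc a + val T j)
      ≡⟨ cong suc (π-right j) ⟨
    suc (val π (suc a ↑ʳ j))
      ≡⟨ toℕ-punchIn-≥ c _ (c≤ (above _ (↑ʳ-≥ j))) ⟨
    toℕ (punchIn c (π ⟨$⟩ʳ (suc a ↑ʳ j))) ∎)
    where
    open ≡-Reasoning
    c≤ : ∀ {x} → suc a ℕ.≤ x → toℕ c ℕ.≤ x
    c≤ {x} = subst (ℕ._≤ x) (sym c≡a)

  position : ∀ {i} → c < i → Σ[ j ∈ Fin N ] toℕ i ≡ suc a + suc (toℕ j)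
  position {i} c<i =
    let d , eq = ℕ.m≤n⇒∃[o]m+o≡n (subst (ℕ._< toℕ i) c≡a c<i)
        eq′ = trans (sym eq) (sym (ℕ.+-suc (suc a) d))
        d<N = ℕ.s<s⁻¹ (ℕ.+-cancelˡ-< (suc a) _ _
                (subst₂ ℕ._<_ eq′ (sym (ℕ.+-suc (suc a) N)) (Fin.toℕ<n i)))
    in fromℕ< d<N , trans eq′ (cong (λ x → suc a + suc x) (sym (Fin.toℕ-fromℕ< d<N)))

  avoids : ∀ {i j l} → (Σ[ x ∈ Fin N ] toℕ i ≡ suc a + suc (toℕ x)) →
           (Σ[ x ∈ Fin N ] toℕ j ≡ suc a + suc (toℕ x)) →
           (Σ[ x ∈ Fin N ] toℕ l ≡ suc a + suc (toℕ x)) →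
           i < j → j < l → val ρ j ℕ.< val ρ i → val ρ i ℕ.< val ρ l → ⊥
  avoids (i′ , i≡) (j′ , j≡) (l′ , l≡) i<j j<l lt lt′ =
    id-⊕-avoids213 {m = m} τ τ-avoids (shift i≡ j≡ i<j) (shift j≡ l≡ j<l)
      (shift (value j≡) (value i≡) lt) (shift (value i≡) (value l≡) lt′)
    where
    shift : ∀ {x y x′ y′} → x ≡ suc a + suc x′ → y ≡ suc a + suc y′ → x ℕ.< y → x′ ℕ.< y′
    shift x≡ y≡ = ℕ.s<s⁻¹ ∘ ℕ.+-cancelˡ-< (suc a) _ _ ∘ subst₂ ℕ._<_ x≡ y≡
    value : ∀ {x x′} → toℕ x ≡ suc a + suc (toℕ x′) → val ρ x ≡ suc a + suc (val T x′)
    value {x′ = x′} x≡ = trans (ρ-right {j = suc x′} x≡) (cong (suc a +_) (val-id-suc {m = m} τ x′))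

reflects : (π : Permutation′ n) (g : Fin n → ℕ) → (∀ {i j} → val π i ℕ.< val π j → g i ℕ.< g j) →
           ∀ {i j} → g i ℕ.< g j → val π i ℕ.< val π j
reflects π g mono {i} {j} lt with ℕ.<-cmp (val π i) (val π j)
... | tri< πi<πj _ _ = πi<πj
... | tri> _ _ πj<πi = contradiction lt (ℕ.<-asym (mono πj<πi))
... | tri≈ _ πi≡πj _ with refl ← val-injective π πi≡πj = contradiction lt (ℕ.<-irrefl refl)

module _ {π : Permutation′ n} {ρ : Permutation′ (suc n)} (ins : Insertion π ρ) where
  open Insertion ins

  insertion-< : ∀ {j} → j < c → (ρ ⟨$⟩ʳ j) < c
  insertion-< {j} j<c with c ≟ j
  ... | yes refl = contradiction j<c (ℕ.<-irrefl refl)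
  ... | no c≢j   = subst (λ x → (ρ ⟨$⟩ʳ x) < c) i≡j
        (subst (_< c) (sym (off-c i)) (subst (ℕ._< toℕ c) (sym (toℕ-punchIn-< c _ πi<c)) πi<c))
    where
    i = punchOut c≢j
    i≡j = Fin.punchIn-punchOut c≢j
    πi<c = below i (punchIn-<⇒< c (subst (_< c) (sym i≡j) j<c))

  insertion-> : ∀ {j} → c < j → c < (ρ ⟨$⟩ʳ j)
  insertion-> {j} c<j with c ≟ j
  ... | yes refl = contradiction c<j (ℕ.<-irrefl refl)
  ... | no c≢j   = subst (λ x → c < (ρ ⟨$⟩ʳ x)) i≡j
        (subst (c <_) (sym (off-c i)) (subst (toℕ c ℕ.<_) (sym (toℕ-punchIn-≥ c _ c≤πi)) (ℕ.s≤s c≤πi)))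
    where
    i = punchOut c≢j
    i≡j = Fin.punchIn-punchOut c≢j
    c≤πi = above i (punchIn->⇒≥ c (subst (c <_) (sym i≡j) c<j))

  insertion-≤ : ∀ {j} → j ≤ c → (ρ ⟨$⟩ʳ j) ≤ c
  insertion-≤ j≤c with ℕ.m≤n⇒m<n∨m≡n j≤c
  ... | inj₁ j<c = ℕ.<⇒≤ (insertion-< j<c)
  ... | inj₂ j≡c with refl ← toℕ-injective j≡c = ℕ.≤-reflexive (cong toℕ at-c)

  insertion-cut : ∀ {i j} → i < j → i ≤ c → c ≤ j → (ρ ⟨$⟩ʳ i) < (ρ ⟨$⟩ʳ j)
  insertion-cut i<j i≤c c≤j with ℕ.m≤n⇒m<n∨m≡n c≤j
  ... | inj₁ c<j = ℕ.≤-<-trans (insertion-≤ i≤c) (insertion-> c<j)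
  ... | inj₂ c≡j with refl ← toℕ-injective c≡j =
        ℕ.<-≤-trans (insertion-< i<j) (ℕ.≤-reflexive (cong toℕ (sym at-c)))

-- `g` and `g⁺` need only be ordered like π and ρ. This covers the permutations themselves as well
-- as tails left by a deleted first entry, whose values skip a number.
insertion⇒stretch : {π : Permutation′ n} {ρ : Permutation′ (suc n)} → Insertion π ρ →
  {g : Fin n → ℕ} {g⁺ : Fin (suc n) → ℕ} →
  (∀ {i j} → val π i ℕ.< val π j → g i ℕ.< g j) → (∀ {i j} → val ρ i ℕ.< val ρ j → g⁺ i ℕ.< g⁺ j) →
  Stretch g g⁺
insertion⇒stretch {n} {π} {ρ} ins {g} {g⁺} g-mono g⁺-mono = record
  { c         = c
  ; left≢∅    = left≢∅
  ; right≢∅   = right≢∅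
  ; unstretch = λ {i} {j} lt → g-mono (punchIn-cancel-< c
                  (subst₂ _<_ (off-c i) (off-c j) (reflects ρ g⁺ g⁺-mono lt)))
  ; cut       = λ i<c c≤j → g-mono (ℕ.<-≤-trans (below _ i<c) (above _ c≤j))
  ; cut⁺      = λ i<j i≤c c≤j → g⁺-mono (insertion-cut ins i<j i≤c c≤j)
  ; avoids213 = λ c<i i<j j<l lt lt′ →
                  avoids213 c<i i<j j<l (reflects ρ g⁺ g⁺-mono lt) (reflects ρ g⁺ g⁺-mono lt′)
  }
  where
  open Insertion ins

first-∖ : (π : Permutation′ (suc n)) {v : Fin (suc n)} → π ⟨$⟩ʳ 0F ≡ v →
          ∀ i → π ⟨$⟩ʳ suc i ≡ punchIn v ((π ∖ v) ⟨$⟩ʳ i)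
first-∖ π {v} refl i =
  trans (cong (λ x → π ⟨$⟩ʳ punchIn x i) (sym (inverseˡ π))) (punchIn-permute′ π v i)

first-∖-mono : (π : Permutation′ (suc n)) {v : Fin (suc n)} → π ⟨$⟩ʳ 0F ≡ v →
               ∀ {i j} → val (π ∖ v) i ℕ.< val (π ∖ v) j → val π (suc i) ℕ.< val π (suc j)
first-∖-mono π {v} eq {i} {j} lt =
  subst₂ _<_ (sym (first-∖ π eq i)) (sym (first-∖ π eq j)) (punchIn-mono-< v lt)

insertion⇒case₁ : (π : Permutation′ (suc n)) (ρ : Permutation′ (suc (suc n))) {v : Fin (suc n)} →
  Indecomposable π → π ⟨$⟩ʳ 0F ≡ v → ρ ⟨$⟩ʳ 0F ≡ inject₁ v →
  Insertion (π ∖ v) (ρ ∖ inject₁ v) → Case₁ (val π) (val ρ)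
insertion⇒case₁ {n} π ρ {v} indec π₀ ρ₀ ins = record
  { stretch     = insertion⇒stretch ins (first-∖-mono π π₀) (first-∖-mono ρ ρ₀)
  ; above-left  = λ {i} i<c → subst₂ _<_ (sym (first-∖ π π₀ i)) (sym π₀)
                    (<⇒punchIn-< v (ℕ.<-trans (below i i<c) c<v))
  ; above-left⁺ = λ {j} j≤c → subst₂ _<_ (sym (first-∖ ρ ρ₀ j)) (sym ρ₀)
                    (<⇒punchIn-< v⁺ (ℕ.≤-<-trans (insertion-≤ ins j≤c) (subst (toℕ c ℕ.<_) (sym v⁺≡v) c<v)))
  -- Stretching never lowers a value and the first entry keeps its own, so lying below it carries
  -- over from `ρ` to `π`.
  ; drop        = λ {i} lt → subst₂ _<_ (sym (first-∖ π π₀ i)) (sym π₀)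
                    (<⇒punchIn-< v (ℕ.≤-<-trans (punchIn-≥ c _) (subst₂ ℕ._<_ (cong toℕ (off-c i)) v⁺≡v
                      (punchIn-<⇒< v⁺ (subst₂ _<_ (first-∖ ρ ρ₀ (punchIn c i)) ρ₀ lt)))))
  }
  where
  open Insertion ins
  v⁺ = inject₁ v
  v⁺≡v : toℕ v⁺ ≡ toℕ v
  v⁺≡v = Fin.toℕ-inject₁ v

  <⇒punchIn-< : ∀ {m} (c : Fin (suc m)) {i} → toℕ i ℕ.< toℕ c → punchIn c i < c
  <⇒punchIn-< c {i} i<c = subst (ℕ._< toℕ c) (sym (toℕ-punchIn-< c i i<c)) i<c

  punchIn-≥ : ∀ {m} (c : Fin (suc m)) i → toℕ i ℕ.≤ toℕ (punchIn c i)
  punchIn-≥ c i with ℕ.<-≤-connex (toℕ i) (toℕ c)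
  ... | inj₁ i<c = ℕ.≤-reflexive (sym (toℕ-punchIn-< c i i<c))
  ... | inj₂ c≤i = ℕ.≤-trans (ℕ.n≤1+n _) (ℕ.≤-reflexive (sym (toℕ-punchIn-≥ c i c≤i)))

  punchIn-≤ : ∀ {m} (c : Fin (suc m)) i → toℕ (punchIn c i) ℕ.≤ suc (toℕ i)
  punchIn-≤ c i with ℕ.<-≤-connex (toℕ i) (toℕ c)
  ... | inj₁ i<c = ℕ.≤-trans (ℕ.≤-reflexive (toℕ-punchIn-< c i i<c)) (ℕ.n≤1+n _)
  ... | inj₂ c≤i = ℕ.≤-reflexive (toℕ-punchIn-≥ c i c≤i)

  -- Otherwise the first entry could be added to the left block.
  c<v : toℕ c ℕ.< toℕ v
  c<v = ℕ.≰⇒> λ v≤c → indec (cut⇒decomposable π (mkCut (suc (toℕ c)) (ℕ.s≤s ℕ.z≤n) (ℕ.s≤s right≢∅)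
    (λ { 0F _ → subst (λ x → toℕ x ℕ.< suc (toℕ c)) (sym π₀) (ℕ.s≤s v≤c)
       ; (suc i) (ℕ.s≤s i<c) → subst (λ x → toℕ x ℕ.< suc (toℕ c)) (sym (first-∖ π π₀ i))
           (ℕ.s≤s (ℕ.≤-trans (punchIn-≤ v _) (below i i<c))) })
    (λ { (suc i) (ℕ.s≤s c≤i) → subst (λ x → toℕ c ℕ.< toℕ x) (sym (first-∖ π π₀ i))
           (subst (toℕ c ℕ.<_) (sym (toℕ-punchIn-≥ v _ (ℕ.≤-trans v≤c (above i c≤i))))
             (ℕ.s≤s (above i c≤i))) })))

-- Occurrences under inverses and reverse-complements

occ-≗ : {p q : Fin k → ℕ} {f g : Fin n → ℕ} → p ≗ q → f ≗ g → Occ p f → Occ q g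
occ-≗ p≗q f≗g (occ e e-mono e-ordered) = occ e e-mono λ {i} {j} lt →
  subst₂ ℕ._<_ (f≗g _) (f≗g _) (e-ordered (subst₂ ℕ._<_ (sym (p≗q i)) (sym (p≗q j)) lt))

val-≈ : {π ρ : Permutation′ n} → π ≈ ρ → val π ≗ val ρ
val-≈ eq i = cong toℕ (eq i)

-- Taking inverses exchanges positions and values, hence `mono` and `ordered`.
occ-flip : (p : Permutation′ k) (π : Permutation′ n) →
           Occ (val p) (val π) → Occ (val (flip p)) (val (flip π))
occ-flip p π (occ e e-mono e-ordered) = occ (λ i → π ⟨$⟩ʳ e (p ⟨$⟩ˡ i))
  (λ i<j → e-ordered (subst₂ _<_ (sym (inverseʳ p)) (sym (inverseʳ p)) i<j))
  (λ lt → subst₂ _<_ (sym (inverseˡ π)) (sym (inverseˡ π)) (e-mono lt))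

opposite-mono : ∀ {i j : Fin n} → i < j → opposite j < opposite i
opposite-mono {i = i} {j} i<j = balance
  (trans (sym (ℕ.+-suc _ _)) (trans (opposite-sum j) (sym (opposite-sum i)))) i<j

occ-rc : (p : Permutation′ k) (π : Permutation′ n) →
         Occ (val p) (val π) → Occ (val (rc p)) (val (rc π))
occ-rc p π (occ e e-mono e-ordered) = occ (opposite ∘ e ∘ opposite)
  (λ i<j → opposite-mono (e-mono (opposite-mono i<j)))
  (λ lt → subst₂ (λ x y → opposite (π ⟨$⟩ʳ x) < opposite (π ⟨$⟩ʳ y))
     (sym (Fin.opposite-involutive _)) (sym (Fin.opposite-involutive _))
     (opposite-mono (e-ordered (opposite-cancel lt))))
  where
  opposite-cancel : ∀ {i j : Fin _} → opposite i < opposite j → j < i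
  opposite-cancel = subst₂ _<_ (Fin.opposite-involutive _) (Fin.opposite-involutive _) ∘ opposite-mono

occ-rc⁻ : (p : Permutation′ k) (π : Permutation′ n) →
          Occ (val (rc p)) (val (rc π)) → Occ (val p) (val π)
occ-rc⁻ p π =
  occ-≗ (val-≈ {π = rc (rc p)} {p} (rc-rc p)) (val-≈ {π = rc (rc π)} {π} (rc-rc π)) ∘ occ-rc (rc p) (rc π)

-- No deletion at the last position or of the largest value, the ones case₁
-- and case₂ do not look at, decomposes π.
Tight : Permutation′ n → Set
Tight {zero}  π = ⊤
Tight {suc n} π = Indecomposable (π ∖ fromℕ n) × Indecomposable (π ∖ (π ⟨$⟩ʳ fromℕ n))

-- Taking inverses exchanges the last position with the largest value.
tight-flip : {π : Permutation′ (suc n)} → Tight π → Tight (flip π)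
tight-flip {n} {π} (l , πl) =
  (πl ∘ flip-∖ π (fromℕ n)) ,
  (l ∘ subst (λ x → Decomposable (π ∖ x)) (inverseʳ π) ∘ flip-∖ π (π ⟨$⟩ˡ fromℕ n))

opposite-fromℕ : ∀ n → opposite (fromℕ n) ≡ 0F
opposite-fromℕ n = Fin.opposite-involutive 0F

-- The source of tightness: the two hypotheses are those under which `case₃` is entered.
tight-rc : (π : Permutation′ (suc n)) → Indecomposable (π ∖ (π ⟨$⟩ʳ 0F)) →
           Indecomposable (π ∖ 0F) → Tight (rc π)
tight-rc {n} π first zero′ =
  (zero′ ∘ subst (λ x → Decomposable (π ∖ x)) (opposite-fromℕ n) ∘ rc-∖ π (fromℕ n)) ,
  (first ∘ subst (λ x → Decomposable (π ∖ x))
     (trans (Fin.opposite-involutive _) (cong (π ⟨$⟩ʳ_) (opposite-fromℕ n))) ∘ rc-∖ π (rc π ⟨$⟩ʳ fromℕ n))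

-- If the first entry were the largest, deleting the largest value would decompose π. The witness is
-- the maximum of π.
tight⇒larger : (π : Permutation′ (suc n)) → Tight π → Decomposable (π ∖ (π ⟨$⟩ʳ 0F)) →
               ∃[ u ] val π 0F ℕ.< val π (suc u)
tight⇒larger {n} π (l , _) dec = larger (π ⟨$⟩ˡ fromℕ n) (inverseʳ π)
  where
  larger : ∀ i → π ⟨$⟩ʳ i ≡ fromℕ n → ∃[ u ] val π 0F ℕ.< val π (suc u)
  larger 0F      πi = contradiction (subst (λ x → Decomposable (π ∖ x)) πi dec) l
  larger (suc u) πi = u , subst (λ x → (π ⟨$⟩ʳ 0F) < x) (sym πi) (≢fromℕ⇒< λ l≡π₀ →
    contradiction (⟨$⟩ʳ-injective π (trans πi l≡π₀)) λ ())

-- `case₃` leads from `pullA` to `pullB`, as `rc` takes `A` to `B`. `B-case₁` may use an entry above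
-- the first one, because `pullB` is restricted to tight permutations.
module Pull {k} (A B : Permutation′ k → Set)
  (A-flip : ∀ p → A p → A (flip p)) (A-rc : ∀ p → A p → B (rc p))
  (B-flip : ∀ p → B p → B (flip p)) (B-rc : ∀ p → B p → A (rc p))
  (A-stretch : ∀ {n} {g : Fin n → ℕ} {g⁺} p → A p → Stretch g g⁺ → Occ (val p) g⁺ → Occ (val p) g)
  (B-stretch : ∀ {n} {g : Fin n → ℕ} {g⁺} p → B p → Stretch g g⁺ → Occ (val p) g⁺ → Occ (val p) g)
  (A-case₁ : ∀ {n} {f : Fin (suc n) → ℕ} {f⁺} p → A p → Case₁ f f⁺ → Occ (val p) f⁺ → Occ (val p) f)
  (B-case₁ : ∀ {n} {f : Fin (suc n) → ℕ} {f⁺} p → B p → Case₁ f f⁺ → (∃[ u ] f 0F ℕ.< f (suc u)) →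
             Occ (val p) f⁺ → Occ (val p) f)
  where

  pullA : {π : Permutation′ n} {ρ : Permutation′ (suc n)} → π f↦ ρ → ∀ p → A p →
          Occ (val p) (val ρ) → Occ (val p) (val π)
  pullB : {π : Permutation′ n} {ρ : Permutation′ (suc n)} → π f↦ ρ → Tight π → ∀ p → B p →
          Occ (val p) (val ρ) → Occ (val p) (val π)

  pullA (decomposable _ _ s) p a =
    A-stretch p a (insertion⇒stretch (f̃⇒insertion s) (λ lt → lt) λ lt → lt)
  pullA (case₁ {π = π} {ρ} _ (indec , _) _ ρ₀ s) p a =
    A-case₁ p a (insertion⇒case₁ π ρ indec refl ρ₀ (f̃⇒insertion s))
  pullA (case₂ {π = π} {ρ} {ρ′} _ _ _ d ρ≈) p a =
    -- `flip` is involutive by computation, so this lands in `p` and `π` again; `rc` is involutive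
    -- only pointwise and needs `rc-rc`.
    occ-flip (flip p) (flip π) ∘ pullA d (flip p) (A-flip p a) ∘ occ-flip p (flip ρ′) ∘
    occ-≗ (λ _ → refl) (val-≈ {π = ρ} {flip ρ′} ρ≈)
  pullA (case₃ {π = π} {ρ} {ρ′} _ _ indec indec′ d ρ≈) p a =
    occ-rc⁻ p π ∘ pullB d (tight-rc π indec indec′) (rc p) (A-rc p a) ∘
    occ-≗ (λ _ → refl) (val-≈ {π = rc (rc ρ′)} {ρ′} (rc-rc ρ′)) ∘ occ-rc p (rc ρ′) ∘
    occ-≗ (λ _ → refl) (val-≈ {π = ρ} {rc ρ′} ρ≈)

  pullB (decomposable _ _ s) _ p b =
    B-stretch p b (insertion⇒stretch (f̃⇒insertion s) (λ lt → lt) λ lt → lt)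
  pullB (case₁ {π = π} {ρ} _ (indec , _) dec ρ₀ s) tight p b =
    B-case₁ p b (insertion⇒case₁ π ρ indec refl ρ₀ (f̃⇒insertion s)) (tight⇒larger π tight dec)
  pullB (case₂ {π = π} {ρ} {ρ′} _ _ _ d ρ≈) tight p b =
    occ-flip (flip p) (flip π) ∘ pullB d (tight-flip {π = π} tight) (flip p) (B-flip p b) ∘
    occ-flip p (flip ρ′) ∘
    occ-≗ (λ _ → refl) (val-≈ {π = ρ} {flip ρ′} ρ≈)
  -- For tight π all four deletions would be indecomposable here, against almost decomposability; as
  -- `rc` leads back to `A`, the clause closes without this argument.
  pullB (case₃ {π = π} {ρ} {ρ′} _ _ _ _ d ρ≈) tight p b =
    occ-rc⁻ p π ∘ pullA d (rc p) (B-rc p b) ∘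
    occ-≗ (λ _ → refl) (val-≈ {π = rc (rc ρ′)} {ρ′} (rc-rc ρ′)) ∘ occ-rc p (rc ρ′) ∘
    occ-≗ (λ _ → refl) (val-≈ {π = ρ} {rc ρ′} ρ≈)

  compatible : ∀ p → A p → FCompatible p
  compatible p a π _ _ avoids ρ d contains =
    avoids (occ⇒contains {π = π} {p} (pullA d p a (contains⇒occ {π = ρ} {p} contains)))

-- The compatible patterns

EndToEnd : Permutation′ (suc k) → Set
EndToEnd {k} p = p ⟨$⟩ʳ 0F ≡ fromℕ k × p ⟨$⟩ʳ fromℕ k ≡ 0F

endToEnd-flip : (p : Permutation′ (suc k)) → EndToEnd p → EndToEnd (flip p)
endToEnd-flip p (p₀ , pₗ) =
  trans (cong (p ⟨$⟩ˡ_) (sym pₗ)) (inverseˡ p) , trans (cong (p ⟨$⟩ˡ_) (sym p₀)) (inverseˡ p)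

endToEnd-rc : (p : Permutation′ (suc k)) → EndToEnd p → EndToEnd (rc p)
endToEnd-rc {k} p (p₀ , pₗ) = cong opposite pₗ ,
  trans (cong opposite (trans (cong (p ⟨$⟩ʳ_) (opposite-fromℕ k)) p₀)) (opposite-fromℕ k)

endToEnd⇒ends : (p : Permutation′ (suc (suc k))) → EndToEnd p → Ends (val p)
endToEnd⇒ends {k} p (p₀ , pₗ) =
  (λ i → subst (λ x → (p ⟨$⟩ʳ suc i) < x) (sym p₀) (≢fromℕ⇒< λ l≡pᵢ →
     contradiction (⟨$⟩ʳ-injective p (trans p₀ l≡pᵢ)) λ ())) ,
  (λ i → subst (λ x → x < (p ⟨$⟩ʳ punchIn (fromℕ (suc k)) i)) (sym pₗ) (ℕ.n≢0⇒n>0 λ pᵢ≡0 →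
     Fin.punchInᵢ≢i (fromℕ (suc k)) i (⟨$⟩ʳ-injective p (trans (toℕ-injective pᵢ≡0) (sym pₗ)))))

-- Closed under both symmetries and independent of larger entries, these patterns serve as both
-- classes at once.
endToEnd⇒compatible : (p : Permutation′ (suc k)) → EndToEnd p → FCompatible p
-- The pattern 1 has no inversion and is treated by hand: every nonempty permutation contains it.
endToEnd⇒compatible {zero} p _ {zero} π (inj₁ dec) with () ← Cut.<n (decomposable⇒cut π dec)
endToEnd⇒compatible {zero} p _ {suc n} π _ _ avoids _ _ _ = avoids (occ⇒contains {π = π} {p}
  (occ (λ _ → 0F) (λ { {0F} {0F} () }) (λ { {0F} {0F} lt → contradiction lt (ℕ.<-irrefl refl) })))
endToEnd⇒compatible {suc k} = Pull.compatible EndToEnd EndToEnd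
  endToEnd-flip endToEnd-rc endToEnd-flip endToEnd-rc stretch stretch
  (λ p e C → ends-case₁ C (endToEnd⇒ends p e)) (λ p e C _ → ends-case₁ C (endToEnd⇒ends p e))
  where
  stretch : ∀ {n} {g : Fin n → ℕ} {g⁺} (p : Permutation′ (suc (suc k))) → EndToEnd p →
            Stretch g g⁺ → Occ (val p) g⁺ → Occ (val p) g
  stretch p e S = rigid-unstretch S (maxFirst⇒Rigid (proj₁ (endToEnd⇒ends p e)))

edge? : (p : Fin k → ℕ) → ∀ i j → Dec (Edge p i j)
edge? p i j = (i <? j ×-dec p j ℕ.<? p i) ⊎-dec (j <? i ×-dec p i ℕ.<? p j)

rigid? : (p : Fin k → ℕ) → Dec (Rigid p)
rigid? p = Fin.all? λ i → Fin.all? λ j →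
  edge? p i j ⊎-dec Fin.any? λ x → edge? p i x ×-dec edge? p x j

low? : (p : Fin (suc k) → ℕ) → Dec (Low p)
low? {k} p = 0 ℕ.<? k ×-dec (Fin.all? λ i → p 0F ℕ.<? p (suc i)) ×-dec rigid? (p ∘ suc)

high? : (p : Fin (suc k) → ℕ) → Dec (High p)
high? {k} p = 0 ℕ.<? k ×-dec (Fin.all? λ i → p (punchIn (fromℕ k) i) ℕ.<? p (fromℕ k))
              ×-dec rigid? (p ∘ punchIn (fromℕ k))

blocked? : (p : Fin (suc k) → ℕ) → Dec (Blocked p)
blocked? {k} p = Fin.any? λ i → Fin.any? λ j → 0 ℕ.<? toℕ i ×-dec i <? j ×-dec j <? fromℕ k ×-dec
  p 0F ℕ.<? p i ×-dec p j ℕ.<? p i ×-dec p i ℕ.<? p (fromℕ k)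

capped? : (p : Fin (suc (suc k)) → ℕ) → Dec (Capped p)
capped? {k} p = (Fin.all? λ i → p (suc (punchIn (fromℕ k) i)) ℕ.<? p 0F) ×-dec high? (p ∘ suc)

-- `Capped` is reserved for the second class, the one that has a larger entry at its disposal.
AShape BShape : (Fin (suc (suc k)) → ℕ) → Set
AShape p = Low p ⊎ (High p × Blocked p)
BShape p = Low p ⊎ (High p × (Blocked p ⊎ Capped p))

infix 4 _≈?_
_≈?_ : (p q : Permutation′ n) → Dec (p ≈ q)
p ≈? q = Fin.all? λ i → p ⟨$⟩ʳ i ≟ q ⟨$⟩ʳ i

flip-≈ : (p q : Permutation′ n) → p ≈ q → flip p ≈ flip q
flip-≈ p q p≈q i = ⟨$⟩ʳ-injective q (trans (sym (p≈q _)) (trans (inverseʳ p) (sym (inverseʳ q))))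

rc-≈ : (p q : Permutation′ n) → p ≈ q → rc p ≈ rc q
rc-≈ p q p≈q i = cong opposite (p≈q _)

Listed : List (Permutation′ k) → Permutation′ k → Set
Listed ps p = Any (λ q → p ≈ q) ps

listed? : (ps : List (Permutation′ k)) → ∀ p → Dec (Listed ps p)
listed? ps p = Any.any? (p ≈?_) ps

lookup-listed : ∀ {P : Permutation′ k → Set} {ps} p → All P ps → Listed ps p → ∃[ q ] p ≈ q × P q
lookup-listed p all any = Any.lookup any , lookup-result any , proj₁ (All.lookupAny all any)

module _ (As Bs : List (Permutation′ (suc (suc k)))) where

  Closed : Set
  Closed = All (λ q → AShape (val q) × Listed As (flip q) × Listed Bs (rc q)) As
         × All (λ q → BShape (val q) × Listed Bs (flip q) × Listed As (rc q)) Bs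

  closed? : Dec Closed
  closed? = All.all? (λ q → (low? (val q) ⊎-dec (high? (val q) ×-dec blocked? (val q)))
                       ×-dec listed? As (flip q) ×-dec listed? Bs (rc q)) As
      ×-dec All.all? (λ q → (low? (val q) ⊎-dec
                         (high? (val q) ×-dec (blocked? (val q) ⊎-dec capped? (val q))))
                       ×-dec listed? Bs (flip q) ×-dec listed? As (rc q)) Bs

  listed⇒compatible : Closed → ∀ p → Listed As p → FCompatible p
  listed⇒compatible (as , bs) = Pull.compatible (Listed As) (Listed Bs)
    (λ p l → let q , p≈q , _ , c , _ = lookup-listed p as l in
       Any.map (λ q≈ i → trans (flip-≈ p q p≈q i) (q≈ i)) c)
    (λ p l → let q , p≈q , _ , _ , c = lookup-listed p as l in
       Any.map (λ q≈ i → trans (rc-≈ p q p≈q i) (q≈ i)) c)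
    (λ p l → let q , p≈q , _ , c , _ = lookup-listed p bs l in
       Any.map (λ q≈ i → trans (flip-≈ p q p≈q i) (q≈ i)) c)
    (λ p l → let q , p≈q , _ , _ , c = lookup-listed p bs l in
       Any.map (λ q≈ i → trans (rc-≈ p q p≈q i) (q≈ i)) c)
    (λ p l S → let q , p≈q , s , _ = lookup-listed p as l in via p q p≈q (a-stretch S s))
    (λ p l S → let q , p≈q , s , _ = lookup-listed p bs l in via p q p≈q (b-stretch S s))
    (λ p l C → let q , p≈q , s , _ = lookup-listed p as l in via p q p≈q (a-case₁ C s))
    (λ p l C u → let q , p≈q , s , _ = lookup-listed p bs l in via p q p≈q (b-case₁ C u s))
    where
    via : ∀ {n n′} {f : Fin n → ℕ} {g : Fin n′ → ℕ} (p q : Permutation′ (suc (suc k))) → p ≈ q →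
          (Occ (val q) f → Occ (val q) g) → Occ (val p) f → Occ (val p) g
    via p q p≈q h = occ-≗ (sym ∘ val-≈ {π = p} {q} p≈q) (λ _ → refl) ∘ h ∘
                    occ-≗ (val-≈ {π = p} {q} p≈q) (λ _ → refl)

    a-stretch : ∀ {n} {g : Fin n → ℕ} {g⁺} → Stretch g g⁺ →
                ∀ {p : Fin (suc (suc k)) → ℕ} → AShape p → Occ p g⁺ → Occ p g
    a-stretch S (inj₁ low)        = low-unstretch S low
    a-stretch S (inj₂ (high , _)) = high-unstretch S high

    b-stretch : ∀ {n} {g : Fin n → ℕ} {g⁺} → Stretch g g⁺ →
                ∀ {p : Fin (suc (suc k)) → ℕ} → BShape p → Occ p g⁺ → Occ p g
    b-stretch S (inj₁ low)        = low-unstretch S low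
    b-stretch S (inj₂ (high , _)) = high-unstretch S high

    a-case₁ : ∀ {n} {f : Fin (suc n) → ℕ} {f⁺} → Case₁ f f⁺ →
              ∀ {p : Fin (suc (suc k)) → ℕ} → AShape p → Occ p f⁺ → Occ p f
    a-case₁ C (inj₁ low)              = low-case₁ C low
    a-case₁ C (inj₂ (high , blocked)) = blocked-case₁ C high blocked

    b-case₁ : ∀ {n} {f : Fin (suc n) → ℕ} {f⁺} → Case₁ f f⁺ → (∃[ u ] f 0F ℕ.< f (suc u)) →
              ∀ {p : Fin (suc (suc k)) → ℕ} → BShape p → Occ p f⁺ → Occ p f
    b-case₁ C u (inj₁ low)                   = low-case₁ C low
    b-case₁ C u (inj₂ (high , inj₁ blocked)) = blocked-case₁ C high blocked
    b-case₁ C u (inj₂ (high , inj₂ capped))  = capped-case₁ C u high capped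

-- Decision procedures

-- Choosing e 0F = x turns the constraint R between 0F and a later entry into a
-- unary one; the newest constraints are tested first, as they fail most often.
search : ∀ k {U : Fin k → Fin n → Set} {R : Fin k → Fin k → Fin n → Fin n → Set} →
         (∀ i x → Dec (U i x)) → (∀ i j x y → Dec (R i j x y)) →
         Dec (Σ[ e ∈ (Fin k → Fin n) ] (∀ i → U i (e i)) × (∀ {i j} → i < j → R i j (e i) (e j)))
search zero    U? R? = yes ((λ ()) , (λ ()) , λ { {()} })
search {n} (suc k) {U} {R} U? R? = map′ cons uncons (Fin.any? λ x → U? 0F x ×-dec
  search k (λ i y → R? 0F (suc i) x y ×-dec U? (suc i) y) (λ i j → R? (suc i) (suc j)))
  where
  Sol : Set
  Sol = Σ[ e ∈ (Fin (suc k) → Fin n) ] (∀ i → U i (e i)) × (∀ {i j} → i < j → R i j (e i) (e j))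
  Step : Set
  Step = ∃[ x ] U 0F x × (Σ[ e ∈ (Fin k → Fin n) ] (∀ i → R 0F (suc i) x (e i) × U (suc i) (e i)) ×
    (∀ {i j} → i < j → R (suc i) (suc j) (e i) (e j)))
  cons : Step → Sol
  cons (x , u , e , us , rs) = e⁺ , us⁺ , rs⁺
    where
    e⁺ : Fin (suc k) → Fin n
    e⁺ 0F      = x
    e⁺ (suc i) = e i
    us⁺ : ∀ i → U i (e⁺ i)
    us⁺ 0F      = u
    us⁺ (suc i) = proj₂ (us i)
    rs⁺ : ∀ {i j} → i < j → R i j (e⁺ i) (e⁺ j)
    rs⁺ {0F}    {suc j} _   = proj₁ (us j)
    rs⁺ {suc i} {suc j} i<j = rs (ℕ.s<s⁻¹ i<j)
  uncons : Sol → Step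
  uncons (e , us , rs) =
    e 0F , us 0F , e ∘ suc , (λ i → rs (ℕ.s≤s ℕ.z≤n) , us (suc i)) , λ i<j → rs (ℕ.s≤s i<j)

-- `search` supplies only pairs i < j, so each pair is tested for both directions of `ordered`.
occ? : (p : Vec ℕ k) (f : Vec ℕ n) → Dec (Occ (Vec.lookup p) (Vec.lookup f))
occ? {k} {n} p f = map′ from to
  (search k {U = λ _ _ → ⊤} (λ _ _ → yes tt) λ i j x y → x <? y ×-dec
    (Vec.lookup p i ℕ.<? Vec.lookup p j →-dec Vec.lookup f x ℕ.<? Vec.lookup f y) ×-dec
    (Vec.lookup p j ℕ.<? Vec.lookup p i →-dec Vec.lookup f y ℕ.<? Vec.lookup f x))
  where
  Embedding : Set
  Embedding = Σ[ e ∈ (Fin k → Fin n) ] (∀ i → ⊤) × (∀ {i j} → i < j → e i < e j ×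
    (Vec.lookup p i ℕ.< Vec.lookup p j → Vec.lookup f (e i) ℕ.< Vec.lookup f (e j)) ×
    (Vec.lookup p j ℕ.< Vec.lookup p i → Vec.lookup f (e j) ℕ.< Vec.lookup f (e i)))
  from : Embedding → Occ (Vec.lookup p) (Vec.lookup f)
  from (e , _ , ok) = occ e (proj₁ ∘ ok) e-ordered
    where
    e-ordered : ∀ {i j} → Vec.lookup p i ℕ.< Vec.lookup p j →
                Vec.lookup f (e i) ℕ.< Vec.lookup f (e j)
    e-ordered {i} {j} lt with ℕ.<-cmp (toℕ i) (toℕ j)
    ... | tri< i<j _ _ = proj₁ (proj₂ (ok i<j)) lt
    ... | tri> _ _ j<i = proj₂ (proj₂ (ok j<i)) lt
    ... | tri≈ _ i≡j _ with refl ← toℕ-injective i≡j = contradiction lt (ℕ.<-irrefl refl)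
  to : Occ (Vec.lookup p) (Vec.lookup f) → Embedding
  to (occ e e-mono e-ordered) = e , (λ _ → tt) , λ i<j → e-mono i<j , e-ordered , e-ordered

-- The values are tabulated so that evaluation computes each of them once.
contains? : (π : Permutation′ n) (p : Permutation′ k) → Dec (Contains π p)
contains? π p = map′
  (occ⇒contains {π = π} {p} ∘ occ-≗ (Vec.lookup∘tabulate (val p)) (Vec.lookup∘tabulate (val π)))
  (occ-≗ (sym ∘ Vec.lookup∘tabulate (val p)) (sym ∘ Vec.lookup∘tabulate (val π))
    ∘ contains⇒occ {π = π} {p})
  (occ? (Vec.tabulate (val p)) (Vec.tabulate (val π)))

avoids? : (π : Permutation′ n) (p : Permutation′ k) → Dec (Avoids π p)
avoids? π p = ¬? (contains? π p)

decomposable? : (π : Permutation′ n) → Dec (Decomposable π)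
decomposable? {n} π = map′
  (λ (s , s<n , 0<s , below , above) → cut⇒decomposable π (mkCut s 0<s s<n below above))
  (λ dec → let mkCut s 0<s s<n below above = decomposable⇒cut π dec in s , s<n , 0<s , below , above)
  (ℕ.anyUpTo? (λ s → 0 ℕ.<? s ×-dec (Fin.all? λ i → toℕ i ℕ.<? s →-dec val π i ℕ.<? s)
                ×-dec (Fin.all? λ i → s ℕ.≤? toℕ i →-dec s ℕ.≤? val π i)) n)

almostDecomposable? : (π : Permutation′ n) → Dec (AlmostDecomposable π)
almostDecomposable? {zero}  π = no λ ()
almostDecomposable? {suc n} π = ¬? (decomposable? π) ×-dec
  Fin.any? λ e → (DecMembership._∈?_ _≟_ e _) ×-dec decomposable? (π ∖ e)

position : Vec (Fin m) (suc n) → Fin m → Fin (suc n)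
-- A value that does not occur also ends up at the last index; the check in `perm` rejects such
-- lists.
position (x ∷ [])     v = 0F
position (x ∷ y ∷ xs) v with x ≟ v
... | yes _ = 0F
... | no  _ = suc (position (y ∷ xs) v)

perm : (xs : Vec (Fin (suc n)) (suc n)) →
       {True ((Fin.all? λ v → Vec.lookup xs (position xs v) ≟ v)
              ×-dec (Fin.all? λ i → position xs (Vec.lookup xs i) ≟ i))} →
       Permutation′ (suc n)
perm xs {ok} =
  permutation (Vec.lookup xs) (position xs) (proj₁ (toWitness ok)) (proj₂ (toWitness ok))

Stretches : Permutation′ n → Permutation′ (suc n) →
            ℕ → Permutation′ (suc a) → Permutation′ (suc b) → Set
Stretches π ρ m σ τ =
  Indecomposable σ × Avoids σ [132] × Indecomposable τ × Avoids τ [213] ×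
  π ≋ σ ⊕ (id {m} ⊕ τ) × ρ ≋ σ ⊕ (id {suc m} ⊕ τ)

stretches? : (π : Permutation′ n) (ρ : Permutation′ (suc n)) →
             ∀ m (σ : Permutation′ (suc a)) (τ : Permutation′ (suc b)) →
             Dec (Stretches π ρ m σ τ)
stretches? π ρ m σ τ =
  ¬? (decomposable? σ) ×-dec avoids? σ [132] ×-dec ¬? (decomposable? τ) ×-dec avoids? τ [213] ×-dec
  List.≡-dec ℕ._≟_ _ _ ×-dec List.≡-dec ℕ._≟_ _ _

stretches⇒f̃ : (π : Permutation′ n) (ρ : Permutation′ (suc n))
              (m : ℕ) (σ : Permutation′ (suc a)) (τ : Permutation′ (suc b)) →
              Stretches π ρ m σ τ → π f̃↦ ρ
stretches⇒f̃ π ρ m σ τ (σ-indec , σ-avoids , τ-indec , τ-avoids , π≋ , ρ≋) =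
  enlarge m σ τ σ-indec σ-avoids τ-indec τ-avoids π≋ ρ≋

-- Certified values of f

Subject : Permutation′ n → Set
Subject π = Avoids π [1324] × AlmostDecomposable π

subject? : (π : Permutation′ n) → Dec (Subject π)
subject? π = avoids? π [1324] ×-dec almostDecomposable? π

-- `σ`, `m`, `τ` describe the sum that is enlarged where `case₁` is finally reached: at π, its
-- inverse, its reverse-complement or the inverse of the latter. They are supplied so that nothing
-- has to be searched for.
module _ (m : ℕ) (σ : Permutation′ (suc a)) (τ : Permutation′ (suc b)) where

  First Second Third : Permutation′ (suc n) → Permutation′ (suc (suc n)) → Set
  First  π ρ = Subject π × Decomposable (π ∖ (π ⟨$⟩ʳ 0F)) × ρ ⟨$⟩ʳ 0F ≡ inject₁ (π ⟨$⟩ʳ 0F)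
             × Stretches (π ∖ (π ⟨$⟩ʳ 0F)) (ρ ∖ inject₁ (π ⟨$⟩ʳ 0F)) m σ τ
  Second π ρ = Subject π × Decomposable (π ∖ 0F) × First (flip π) (flip ρ)
  Third  π ρ = Subject π × Indecomposable (π ∖ (π ⟨$⟩ʳ 0F)) × Indecomposable (π ∖ 0F)
             × (First (rc π) (rc ρ) ⊎ Second (rc π) (rc ρ))

  first? : (π : Permutation′ (suc n)) (ρ : Permutation′ (suc (suc n))) → Dec (First π ρ)
  first? π ρ = subject? π ×-dec decomposable? (π ∖ (π ⟨$⟩ʳ 0F))
    ×-dec (ρ ⟨$⟩ʳ 0F ≟ inject₁ (π ⟨$⟩ʳ 0F))
    ×-dec stretches? (π ∖ (π ⟨$⟩ʳ 0F)) (ρ ∖ inject₁ (π ⟨$⟩ʳ 0F)) m σ τ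

  second? : (π : Permutation′ (suc n)) (ρ : Permutation′ (suc (suc n))) → Dec (Second π ρ)
  second? π ρ = subject? π ×-dec decomposable? (π ∖ 0F) ×-dec first? (flip π) (flip ρ)

  third? : (π : Permutation′ (suc n)) (ρ : Permutation′ (suc (suc n))) → Dec (Third π ρ)
  third? π ρ = subject? π ×-dec ¬? (decomposable? (π ∖ (π ⟨$⟩ʳ 0F)))
    ×-dec ¬? (decomposable? (π ∖ 0F))
    ×-dec (first? (rc π) (rc ρ) ⊎-dec second? (rc π) (rc ρ))

  first⇒f : (π : Permutation′ (suc n)) (ρ : Permutation′ (suc (suc n))) → First π ρ → π f↦ ρ
  first⇒f π ρ ((avoids , almost) , dec , ρ₀ , s) = case₁ avoids almost dec ρ₀
    (stretches⇒f̃ (π ∖ (π ⟨$⟩ʳ 0F)) (ρ ∖ inject₁ (π ⟨$⟩ʳ 0F)) m σ τ s)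

  second⇒f : (π : Permutation′ (suc n)) (ρ : Permutation′ (suc (suc n))) → Second π ρ → π f↦ ρ
  second⇒f π ρ ((avoids , almost) , dec , s) =
    case₂ avoids almost dec (first⇒f (flip π) (flip ρ) s) λ _ → refl

  third⇒f : (π : Permutation′ (suc n)) (ρ : Permutation′ (suc (suc n))) → Third π ρ → π f↦ ρ
  third⇒f π ρ ((avoids , almost) , indec , indec′ , s) =
    case₃ avoids almost indec indec′ ([ first⇒f (rc π) (rc ρ) , second⇒f (rc π) (rc ρ) ]′ s)
      (sym ∘ rc-rc ρ)

record Instance : Set where
  constructor inst
  field
    {size}  : ℕ
    π       : Permutation′ size
    ρ       : Permutation′ (suc size)
    subject : Subject π
    π↦ρ     : π f↦ ρ

instance₁ : (π : Permutation′ (suc n)) (ρ : Permutation′ (suc (suc n)))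
            (m : ℕ) (σ : Permutation′ (suc a)) (τ : Permutation′ (suc b)) →
            {True (first? m σ τ π ρ)} → Instance
instance₁ π ρ m σ τ {ok} = let s = toWitness ok in inst π ρ (proj₁ s) (first⇒f m σ τ π ρ s)

instance₂ : (π : Permutation′ (suc n)) (ρ : Permutation′ (suc (suc n)))
            (m : ℕ) (σ : Permutation′ (suc a)) (τ : Permutation′ (suc b)) →
            {True (second? m σ τ π ρ)} → Instance
instance₂ π ρ m σ τ {ok} = let s = toWitness ok in inst π ρ (proj₁ s) (second⇒f m σ τ π ρ s)

instance₃ : (π : Permutation′ (suc n)) (ρ : Permutation′ (suc (suc n)))
            (m : ℕ) (σ : Permutation′ (suc a)) (τ : Permutation′ (suc b)) →
            {True (third? m σ τ π ρ)} → Instance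
instance₃ π ρ m σ τ {ok} = let s = toWitness ok in inst π ρ (proj₁ s) (third⇒f m σ τ π ρ s)

-- Exhausting the patterns of a given length

perms : ∀ k → List (Permutation′ k)
perms zero    = id ∷ []
perms (suc k) = cartesianProductWith (insert 0F) (allFin (suc k)) (perms k)

insert-≈ : ∀ {x y : Fin (suc n)} (π ρ : Permutation′ n) → x ≡ y → π ≈ ρ → insert 0F x π ≈ insert 0F y ρ
insert-≈ π ρ refl π≈ρ 0F      = refl
insert-≈ {x = x} π ρ refl π≈ρ (suc i) = cong (punchIn x) (π≈ρ i)

perms-complete : (p : Permutation′ k) → Listed (perms k) p
perms-complete {zero}  p = here λ ()
perms-complete {suc k} p = cartesianProductWith⁺ (insert 0F)
  (λ {x} {q} p₀≡x q≈ i → trans (sym (insert-remove 0F p i)) (insert-≈ (remove 0F p) q p₀≡x q≈ i))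
  (∈-allFin (p ⟨$⟩ʳ 0F)) (perms-complete (remove 0F p))

-- The list of patterns only saves testing p against every instance.
Refutes : Permutation′ k → Instance × List (List ℕ) → Set
Refutes p (w , patterns) =
  oneLine p ∈ patterns × Contains (Instance.ρ w) p × Avoids (Instance.π w) p

module _ (As : List (Permutation′ (suc k))) (good : List (List ℕ))
         (instances : List (Instance × List (List ℕ))) where
  open DecMembership (List.≡-dec ℕ._≟_) using (_∈?_)

  Verdict : Permutation′ (suc k) → Set
  Verdict q =
    (oneLine q ∈ good × Avoids q [1324] × (EndToEnd q ⊎ Listed As q)) ⊎
    (¬ (oneLine q ∈ good) × (Contains q [1324] ⊎ Any (Refutes q) instances))

  verdict? : ∀ q → Dec (Verdict q)
  verdict? q =
    (oneLine q ∈? good ×-dec avoids? q [1324] ×-dec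
      ((q ⟨$⟩ʳ 0F ≟ fromℕ k ×-dec q ⟨$⟩ʳ fromℕ k ≟ 0F) ⊎-dec listed? As q)) ⊎-dec
    (¬? (oneLine q ∈? good) ×-dec (contains? q [1324] ⊎-dec
      Any.any? (λ (w , patterns) → oneLine q ∈? patterns
        ×-dec contains? (Instance.ρ w) q ×-dec avoids? (Instance.π w) q) instances))

  contains-≈ : (π : Permutation′ n) (p q : Permutation′ m) → p ≈ q → Contains π p → Contains π q
  contains-≈ π p q p≈q = occ⇒contains {π = π} {q} ∘ occ-≗ (val-≈ {π = p} {q} p≈q) (λ _ → refl) ∘
    contains⇒occ {π = π} {p}

  contains-≈ˡ : (π ρ : Permutation′ n) (p : Permutation′ m) → π ≈ ρ → Contains π p → Contains ρ p
  contains-≈ˡ π ρ p π≈ρ = occ⇒contains {π = ρ} {p} ∘ occ-≗ (λ _ → refl) (val-≈ {π = π} {ρ} π≈ρ) ∘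
    contains⇒occ {π = π} {p}

  characterize : (∀ p → Listed As p → FCompatible p) → All Verdict (perms (suc k)) →
                 ∀ p → (Avoids p [1324] × FCompatible p) ⇔ (oneLine p ∈ good)
  characterize compatible verdicts p with q , p≈q , verdict ← lookup-listed p verdicts (perms-complete p) =
    mk⇔ (to verdict) (from verdict)
    where
    q≈p = sym ∘ p≈q
    to : Verdict q → Avoids p [1324] × FCompatible p → oneLine p ∈ good
    to (inj₁ (q∈ , _)) _ = subst (_∈ good) (≈⇒≋ q p q≈p) q∈
    to (inj₂ (_ , inj₁ c)) (avoids , _) = contradiction (contains-≈ˡ q p [1324] q≈p c) avoids
    to (inj₂ (_ , inj₂ r)) (_ , compat) =
      let (inst π ρ (avoids , almost) d , _) , _ , c , av = Any.satisfied r in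
      contradiction (contains-≈ ρ q p q≈p c)
        (compat π (inj₂ almost) avoids (av ∘ contains-≈ π p q p≈q) ρ d)
    from : Verdict q → oneLine p ∈ good → Avoids p [1324] × FCompatible p
    from (inj₂ (q∉ , _)) p∈ = contradiction (subst (_∈ good) (≈⇒≋ p q p≈q) p∈) q∉
    from (inj₁ (_ , avoids , reason)) _ = avoids ∘ contains-≈ˡ p q [1324] p≈q , ([ ends , listed ]′ reason)
      where
      ends : EndToEnd q → FCompatible p
      ends (q₀ , qₗ) = endToEnd⇒compatible p (trans (p≈q _) q₀ , trans (p≈q _) qₗ)
      listed : Listed As q → FCompatible p
      listed l = compatible p (Any.map (λ q≈ i → trans (p≈q i) (q≈ i)) l)

-- Counterexamples

-- Of the 23 and 103 patterns of lengths four and five that avoid 1324, 20 and 91 have to be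
-- refuted. Each instance stands with the patterns it is used for.
instances : List (Instance × List (List ℕ))
instances =
  (instance₂ (perm (1F ∷ 6F ∷ 4F ∷ 5F ∷ 0F ∷ 2F ∷ 3F ∷ []))
              (perm (1F ∷ 2F ∷ 7F ∷ 5F ∷ 0F ∷ 6F ∷ 3F ∷ 4F ∷ [])) 0
              (perm (0F ∷ [])) (perm (3F ∷ 4F ∷ 1F ∷ 2F ∷ 0F ∷ [])) ,
    (1 ∷ 2 ∷ 3 ∷ 4 ∷ []) ∷
    (1 ∷ 2 ∷ 4 ∷ 3 ∷ []) ∷
    (2 ∷ 1 ∷ 4 ∷ 3 ∷ []) ∷
    (2 ∷ 3 ∷ 1 ∷ 4 ∷ []) ∷
    (3 ∷ 1 ∷ 4 ∷ 2 ∷ []) ∷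
    (4 ∷ 1 ∷ 3 ∷ 2 ∷ []) ∷
    (4 ∷ 2 ∷ 1 ∷ 3 ∷ []) ∷
    (1 ∷ 2 ∷ 4 ∷ 5 ∷ 3 ∷ []) ∷
    (1 ∷ 2 ∷ 5 ∷ 3 ∷ 4 ∷ []) ∷
    (1 ∷ 2 ∷ 5 ∷ 4 ∷ 3 ∷ []) ∷
    (2 ∷ 1 ∷ 5 ∷ 3 ∷ 4 ∷ []) ∷
    (2 ∷ 3 ∷ 1 ∷ 4 ∷ 5 ∷ []) ∷
    (2 ∷ 3 ∷ 1 ∷ 5 ∷ 4 ∷ []) ∷
    (2 ∷ 3 ∷ 4 ∷ 1 ∷ 5 ∷ []) ∷
    (2 ∷ 3 ∷ 5 ∷ 1 ∷ 4 ∷ []) ∷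
    (2 ∷ 3 ∷ 5 ∷ 4 ∷ 1 ∷ []) ∷
    (2 ∷ 4 ∷ 1 ∷ 5 ∷ 3 ∷ []) ∷
    (2 ∷ 5 ∷ 1 ∷ 4 ∷ 3 ∷ []) ∷
    (2 ∷ 5 ∷ 3 ∷ 1 ∷ 4 ∷ []) ∷
    (4 ∷ 1 ∷ 5 ∷ 2 ∷ 3 ∷ []) ∷
    (5 ∷ 1 ∷ 4 ∷ 2 ∷ 3 ∷ []) ∷
    (5 ∷ 3 ∷ 1 ∷ 4 ∷ 2 ∷ []) ∷
    []) ∷
  (instance₃ (perm (3F ∷ 6F ∷ 1F ∷ 2F ∷ 0F ∷ 5F ∷ 4F ∷ []))
              (perm (3F ∷ 1F ∷ 7F ∷ 2F ∷ 0F ∷ 4F ∷ 6F ∷ 5F ∷ [])) 0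
              (perm (1F ∷ 0F ∷ [])) (perm (3F ∷ 1F ∷ 2F ∷ 0F ∷ [])) ,
    (1 ∷ 4 ∷ 2 ∷ 3 ∷ []) ∷
    (2 ∷ 1 ∷ 3 ∷ 4 ∷ []) ∷
    (2 ∷ 4 ∷ 3 ∷ 1 ∷ []) ∷
    (3 ∷ 2 ∷ 4 ∷ 1 ∷ []) ∷
    (1 ∷ 2 ∷ 3 ∷ 5 ∷ 4 ∷ []) ∷
    (1 ∷ 5 ∷ 2 ∷ 3 ∷ 4 ∷ []) ∷
    (1 ∷ 5 ∷ 2 ∷ 4 ∷ 3 ∷ []) ∷
    (2 ∷ 1 ∷ 3 ∷ 5 ∷ 4 ∷ []) ∷
    (2 ∷ 1 ∷ 5 ∷ 4 ∷ 3 ∷ []) ∷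
    (2 ∷ 5 ∷ 1 ∷ 3 ∷ 4 ∷ []) ∷
    (3 ∷ 1 ∷ 2 ∷ 4 ∷ 5 ∷ []) ∷
    (3 ∷ 1 ∷ 5 ∷ 2 ∷ 4 ∷ []) ∷
    (3 ∷ 2 ∷ 1 ∷ 4 ∷ 5 ∷ []) ∷
    (3 ∷ 2 ∷ 5 ∷ 1 ∷ 4 ∷ []) ∷
    (4 ∷ 2 ∷ 5 ∷ 3 ∷ 1 ∷ []) ∷
    (5 ∷ 2 ∷ 1 ∷ 3 ∷ 4 ∷ []) ∷
    []) ∷
  (instance₁ (perm (4F ∷ 0F ∷ 5F ∷ 6F ∷ 2F ∷ 3F ∷ 1F ∷ []))
              (perm (4F ∷ 0F ∷ 1F ∷ 6F ∷ 7F ∷ 3F ∷ 5F ∷ 2F ∷ [])) 0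
              (perm (0F ∷ [])) (perm (3F ∷ 4F ∷ 1F ∷ 2F ∷ 0F ∷ [])) ,
    (2 ∷ 4 ∷ 1 ∷ 3 ∷ []) ∷
    (3 ∷ 1 ∷ 2 ∷ 4 ∷ []) ∷
    (2 ∷ 1 ∷ 4 ∷ 5 ∷ 3 ∷ []) ∷
    (2 ∷ 4 ∷ 5 ∷ 1 ∷ 3 ∷ []) ∷
    (2 ∷ 4 ∷ 5 ∷ 3 ∷ 1 ∷ []) ∷
    (3 ∷ 1 ∷ 2 ∷ 5 ∷ 4 ∷ []) ∷
    (3 ∷ 1 ∷ 5 ∷ 4 ∷ 2 ∷ []) ∷
    (3 ∷ 5 ∷ 2 ∷ 4 ∷ 1 ∷ []) ∷
    (4 ∷ 1 ∷ 2 ∷ 3 ∷ 5 ∷ []) ∷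
    (4 ∷ 1 ∷ 2 ∷ 5 ∷ 3 ∷ []) ∷
    (4 ∷ 1 ∷ 3 ∷ 5 ∷ 2 ∷ []) ∷
    (5 ∷ 1 ∷ 2 ∷ 4 ∷ 3 ∷ []) ∷
    []) ∷
  (instance₃ (perm (4F ∷ 3F ∷ 5F ∷ 0F ∷ 1F ∷ 6F ∷ 2F ∷ []))
              (perm (4F ∷ 2F ∷ 5F ∷ 0F ∷ 1F ∷ 6F ∷ 7F ∷ 3F ∷ [])) 0
              (perm (0F ∷ [])) (perm (3F ∷ 4F ∷ 0F ∷ 2F ∷ 1F ∷ [])) ,
    (1 ∷ 3 ∷ 4 ∷ 2 ∷ []) ∷
    (1 ∷ 3 ∷ 4 ∷ 5 ∷ 2 ∷ []) ∷
    (2 ∷ 1 ∷ 3 ∷ 4 ∷ 5 ∷ []) ∷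
    (2 ∷ 3 ∷ 4 ∷ 5 ∷ 1 ∷ []) ∷
    (3 ∷ 1 ∷ 4 ∷ 5 ∷ 2 ∷ []) ∷
    (3 ∷ 5 ∷ 1 ∷ 2 ∷ 4 ∷ []) ∷
    (4 ∷ 2 ∷ 1 ∷ 5 ∷ 3 ∷ []) ∷
    (4 ∷ 2 ∷ 5 ∷ 1 ∷ 3 ∷ []) ∷
    (5 ∷ 3 ∷ 1 ∷ 2 ∷ 4 ∷ []) ∷
    []) ∷
  (instance₂ (perm (1F ∷ 3F ∷ 5F ∷ 6F ∷ 4F ∷ 2F ∷ 0F ∷ []))
              (perm (1F ∷ 2F ∷ 4F ∷ 6F ∷ 7F ∷ 5F ∷ 0F ∷ 3F ∷ [])) 0
              (perm (0F ∷ [])) (perm (4F ∷ 0F ∷ 3F ∷ 1F ∷ 2F ∷ [])) ,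
    (3 ∷ 4 ∷ 1 ∷ 2 ∷ []) ∷
    (4 ∷ 3 ∷ 1 ∷ 2 ∷ []) ∷
    (1 ∷ 2 ∷ 3 ∷ 4 ∷ 5 ∷ []) ∷
    (2 ∷ 5 ∷ 4 ∷ 1 ∷ 3 ∷ []) ∷
    (3 ∷ 4 ∷ 5 ∷ 1 ∷ 2 ∷ []) ∷
    (3 ∷ 5 ∷ 4 ∷ 1 ∷ 2 ∷ []) ∷
    (4 ∷ 5 ∷ 3 ∷ 1 ∷ 2 ∷ []) ∷
    []) ∷
  (instance₁ (perm (6F ∷ 0F ∷ 5F ∷ 2F ∷ 4F ∷ 3F ∷ 1F ∷ []))
              (perm (6F ∷ 0F ∷ 1F ∷ 7F ∷ 3F ∷ 5F ∷ 4F ∷ 2F ∷ [])) 0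
              (perm (0F ∷ [])) (perm (4F ∷ 1F ∷ 3F ∷ 2F ∷ 0F ∷ [])) ,
    (3 ∷ 4 ∷ 2 ∷ 1 ∷ []) ∷
    (4 ∷ 1 ∷ 5 ∷ 3 ∷ 2 ∷ []) ∷
    (4 ∷ 5 ∷ 1 ∷ 3 ∷ 2 ∷ []) ∷
    (4 ∷ 5 ∷ 2 ∷ 3 ∷ 1 ∷ []) ∷
    (4 ∷ 5 ∷ 3 ∷ 2 ∷ 1 ∷ []) ∷
    (5 ∷ 1 ∷ 2 ∷ 3 ∷ 4 ∷ []) ∷
    []) ∷
  (instance₂ (perm (2F ∷ 1F ∷ 6F ∷ 5F ∷ 4F ∷ 0F ∷ 3F ∷ []))
              (perm (2F ∷ 1F ∷ 3F ∷ 7F ∷ 6F ∷ 0F ∷ 5F ∷ 4F ∷ [])) 0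
              (perm (1F ∷ 0F ∷ [])) (perm (3F ∷ 2F ∷ 1F ∷ 0F ∷ [])) ,
    (2 ∷ 3 ∷ 4 ∷ 1 ∷ []) ∷
    (3 ∷ 2 ∷ 1 ∷ 5 ∷ 4 ∷ []) ∷
    (3 ∷ 2 ∷ 4 ∷ 1 ∷ 5 ∷ []) ∷
    (3 ∷ 2 ∷ 4 ∷ 5 ∷ 1 ∷ []) ∷
    (5 ∷ 4 ∷ 1 ∷ 3 ∷ 2 ∷ []) ∷
    []) ∷
  (instance₁ (perm (5F ∷ 2F ∷ 3F ∷ 0F ∷ 1F ∷ 4F ∷ []))
              (perm (5F ∷ 2F ∷ 3F ∷ 0F ∷ 1F ∷ 4F ∷ 6F ∷ [])) 0
              (perm (2F ∷ 3F ∷ 0F ∷ 1F ∷ [])) (perm (0F ∷ [])) ,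
    (3 ∷ 2 ∷ 1 ∷ 4 ∷ []) ∷
    (4 ∷ 2 ∷ 1 ∷ 3 ∷ 5 ∷ []) ∷
    (4 ∷ 2 ∷ 3 ∷ 1 ∷ 5 ∷ []) ∷
    (4 ∷ 3 ∷ 1 ∷ 2 ∷ 5 ∷ []) ∷
    []) ∷
  (instance₂ (perm (1F ∷ 4F ∷ 6F ∷ 5F ∷ 2F ∷ 0F ∷ 3F ∷ []))
              (perm (1F ∷ 2F ∷ 5F ∷ 7F ∷ 6F ∷ 0F ∷ 3F ∷ 4F ∷ [])) 0
              (perm (0F ∷ [])) (perm (3F ∷ 4F ∷ 0F ∷ 2F ∷ 1F ∷ [])) ,
    (4 ∷ 1 ∷ 2 ∷ 3 ∷ []) ∷
    (4 ∷ 5 ∷ 1 ∷ 2 ∷ 3 ∷ []) ∷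
    (5 ∷ 4 ∷ 1 ∷ 2 ∷ 3 ∷ []) ∷
    []) ∷
  (instance₂ (perm (1F ∷ 6F ∷ 2F ∷ 5F ∷ 3F ∷ 4F ∷ 0F ∷ []))
              (perm (1F ∷ 2F ∷ 7F ∷ 3F ∷ 6F ∷ 4F ∷ 0F ∷ 5F ∷ [])) 0
              (perm (0F ∷ [])) (perm (1F ∷ 3F ∷ 4F ∷ 2F ∷ 0F ∷ [])) ,
    (5 ∷ 2 ∷ 3 ∷ 1 ∷ 4 ∷ []) ∷
    (5 ∷ 2 ∷ 4 ∷ 1 ∷ 3 ∷ []) ∷
    (5 ∷ 4 ∷ 2 ∷ 1 ∷ 3 ∷ []) ∷
    []) ∷
  (instance₂ (perm (3F ∷ 2F ∷ 4F ∷ 1F ∷ 5F ∷ 0F ∷ []))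
              (perm (3F ∷ 2F ∷ 4F ∷ 1F ∷ 5F ∷ 0F ∷ 6F ∷ [])) 0
              (perm (3F ∷ 1F ∷ 0F ∷ 2F ∷ [])) (perm (0F ∷ [])) ,
    (3 ∷ 4 ∷ 2 ∷ 1 ∷ 5 ∷ []) ∷
    (4 ∷ 3 ∷ 2 ∷ 1 ∷ 5 ∷ []) ∷
    []) ∷
  (instance₂ (perm (1F ∷ 3F ∷ 4F ∷ 6F ∷ 5F ∷ 0F ∷ 2F ∷ []))
              (perm (1F ∷ 2F ∷ 4F ∷ 5F ∷ 7F ∷ 0F ∷ 6F ∷ 3F ∷ [])) 0
              (perm (0F ∷ [])) (perm (4F ∷ 0F ∷ 1F ∷ 3F ∷ 2F ∷ [])) ,
    (3 ∷ 4 ∷ 1 ∷ 5 ∷ 2 ∷ []) ∷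
    (3 ∷ 5 ∷ 1 ∷ 4 ∷ 2 ∷ []) ∷
    []) ∷
  (instance₂ (perm (1F ∷ 6F ∷ 3F ∷ 5F ∷ 0F ∷ 4F ∷ 2F ∷ []))
              (perm (1F ∷ 2F ∷ 7F ∷ 4F ∷ 0F ∷ 6F ∷ 5F ∷ 3F ∷ [])) 0
              (perm (0F ∷ [])) (perm (4F ∷ 1F ∷ 3F ∷ 2F ∷ 0F ∷ [])) ,
    (5 ∷ 1 ∷ 4 ∷ 3 ∷ 2 ∷ []) ∷
    (5 ∷ 2 ∷ 1 ∷ 4 ∷ 3 ∷ []) ∷
    []) ∷
  (instance₂ (perm (1F ∷ 6F ∷ 3F ∷ 5F ∷ 4F ∷ 2F ∷ 0F ∷ []))
              (perm (1F ∷ 2F ∷ 7F ∷ 4F ∷ 6F ∷ 5F ∷ 0F ∷ 3F ∷ [])) 0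
              (perm (0F ∷ [])) (perm (4F ∷ 1F ∷ 3F ∷ 2F ∷ 0F ∷ [])) ,
    (5 ∷ 3 ∷ 4 ∷ 1 ∷ 2 ∷ []) ∷
    (5 ∷ 4 ∷ 3 ∷ 1 ∷ 2 ∷ []) ∷
    []) ∷
  (instance₃ (perm (3F ∷ 2F ∷ 4F ∷ 6F ∷ 1F ∷ 0F ∷ 5F ∷ []))
              (perm (3F ∷ 2F ∷ 4F ∷ 1F ∷ 7F ∷ 0F ∷ 5F ∷ 6F ∷ [])) 0
              (perm (0F ∷ [])) (perm (2F ∷ 4F ∷ 3F ∷ 1F ∷ 0F ∷ [])) ,
    (3 ∷ 4 ∷ 2 ∷ 5 ∷ 1 ∷ []) ∷
    (4 ∷ 3 ∷ 2 ∷ 5 ∷ 1 ∷ []) ∷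
    []) ∷
  (instance₃ (perm (3F ∷ 4F ∷ 1F ∷ 0F ∷ 6F ∷ 5F ∷ 2F ∷ []))
              (perm (2F ∷ 4F ∷ 1F ∷ 0F ∷ 5F ∷ 7F ∷ 6F ∷ 3F ∷ [])) 0
              (perm (1F ∷ 0F ∷ [])) (perm (3F ∷ 2F ∷ 0F ∷ 1F ∷ [])) ,
    (1 ∷ 3 ∷ 5 ∷ 4 ∷ 2 ∷ []) ∷
    (3 ∷ 5 ∷ 2 ∷ 1 ∷ 4 ∷ []) ∷
    []) ∷
  (instance₃ (perm (3F ∷ 6F ∷ 1F ∷ 2F ∷ 4F ∷ 0F ∷ 5F ∷ []))
              (perm (3F ∷ 1F ∷ 7F ∷ 2F ∷ 4F ∷ 0F ∷ 5F ∷ 6F ∷ [])) 0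
              (perm (0F ∷ [])) (perm (1F ∷ 4F ∷ 2F ∷ 3F ∷ 0F ∷ [])) ,
    (2 ∷ 5 ∷ 3 ∷ 4 ∷ 1 ∷ []) ∷
    (3 ∷ 2 ∷ 5 ∷ 4 ∷ 1 ∷ []) ∷
    []) ∷
  (instance₃ (perm (4F ∷ 2F ∷ 6F ∷ 3F ∷ 1F ∷ 0F ∷ 5F ∷ []))
              (perm (4F ∷ 2F ∷ 3F ∷ 7F ∷ 1F ∷ 0F ∷ 5F ∷ 6F ∷ [])) 0
              (perm (0F ∷ [])) (perm (4F ∷ 2F ∷ 3F ∷ 1F ∷ 0F ∷ [])) ,
    (3 ∷ 4 ∷ 5 ∷ 2 ∷ 1 ∷ []) ∷
    (4 ∷ 2 ∷ 3 ∷ 5 ∷ 1 ∷ []) ∷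
    []) ∷
  (instance₃ (perm (4F ∷ 6F ∷ 2F ∷ 3F ∷ 1F ∷ 0F ∷ 5F ∷ []))
              (perm (4F ∷ 2F ∷ 7F ∷ 3F ∷ 1F ∷ 0F ∷ 5F ∷ 6F ∷ [])) 0
              (perm (0F ∷ [])) (perm (4F ∷ 2F ∷ 3F ∷ 1F ∷ 0F ∷ [])) ,
    (3 ∷ 5 ∷ 4 ∷ 2 ∷ 1 ∷ []) ∷
    (4 ∷ 3 ∷ 5 ∷ 2 ∷ 1 ∷ []) ∷
    []) ∷
  (instance₂ (perm (1F ∷ 4F ∷ 5F ∷ 2F ∷ 3F ∷ 0F ∷ []))
              (perm (1F ∷ 2F ∷ 5F ∷ 6F ∷ 3F ∷ 0F ∷ 4F ∷ [])) 0
              (perm (0F ∷ [])) (perm (2F ∷ 3F ∷ 0F ∷ 1F ∷ [])) ,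
    (4 ∷ 5 ∷ 2 ∷ 1 ∷ 3 ∷ []) ∷
    []) ∷
  (instance₂ (perm (1F ∷ 5F ∷ 3F ∷ 0F ∷ 4F ∷ 2F ∷ []))
              (perm (1F ∷ 2F ∷ 6F ∷ 0F ∷ 4F ∷ 5F ∷ 3F ∷ [])) 0
              (perm (0F ∷ [])) (perm (3F ∷ 1F ∷ 2F ∷ 0F ∷ [])) ,
    (5 ∷ 1 ∷ 3 ∷ 4 ∷ 2 ∷ []) ∷
    []) ∷
  (instance₁ (perm (3F ∷ 0F ∷ 5F ∷ 4F ∷ 2F ∷ 1F ∷ []))
              (perm (3F ∷ 0F ∷ 1F ∷ 6F ∷ 5F ∷ 4F ∷ 2F ∷ [])) 0
              (perm (0F ∷ [])) (perm (3F ∷ 2F ∷ 1F ∷ 0F ∷ [])) ,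
    (2 ∷ 5 ∷ 4 ∷ 3 ∷ 1 ∷ []) ∷
    []) ∷
  (instance₃ (perm (3F ∷ 2F ∷ 5F ∷ 0F ∷ 1F ∷ 4F ∷ []))
              (perm (3F ∷ 2F ∷ 0F ∷ 6F ∷ 1F ∷ 4F ∷ 5F ∷ [])) 0
              (perm (0F ∷ [])) (perm (3F ∷ 2F ∷ 0F ∷ 1F ∷ [])) ,
    (4 ∷ 3 ∷ 1 ∷ 5 ∷ 2 ∷ []) ∷
    []) ∷
  (instance₃ (perm (3F ∷ 5F ∷ 2F ∷ 0F ∷ 1F ∷ 4F ∷ []))
              (perm (3F ∷ 2F ∷ 6F ∷ 0F ∷ 1F ∷ 4F ∷ 5F ∷ [])) 0
              (perm (0F ∷ [])) (perm (3F ∷ 2F ∷ 0F ∷ 1F ∷ [])) ,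
    (4 ∷ 3 ∷ 5 ∷ 1 ∷ 2 ∷ []) ∷
    []) ∷
  (instance₃ (perm (4F ∷ 3F ∷ 1F ∷ 0F ∷ 5F ∷ 2F ∷ []))
              (perm (4F ∷ 2F ∷ 1F ∷ 0F ∷ 5F ∷ 6F ∷ 3F ∷ [])) 0
              (perm (0F ∷ [])) (perm (3F ∷ 2F ∷ 1F ∷ 0F ∷ [])) ,
    (5 ∷ 3 ∷ 2 ∷ 1 ∷ 4 ∷ []) ∷
    []) ∷
  []

-- The two classes at lengths four and five

A₄ B₄ : List (Permutation′ 4)
A₄ = perm (0F ∷ 3F ∷ 2F ∷ 1F ∷ []) ∷ []
B₄ = perm (2F ∷ 1F ∷ 0F ∷ 3F ∷ []) ∷ []

-- `B₅` consists of the reverse-complements of `A₅`. The pair 14523, 34125 is in both lists, since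
-- 34125 is blocked and its own inverse. 34215 is blocked too, but its inverse 43125 is only capped,
-- so both stay in `B₅` alone. The patterns from 5 to 1 are covered by `EndToEnd`.
A₅ B₅ : List (Permutation′ 5)
A₅ =
  perm (0F ∷ 3F ∷ 4F ∷ 1F ∷ 2F ∷ []) ∷
  perm (0F ∷ 3F ∷ 4F ∷ 2F ∷ 1F ∷ []) ∷
  perm (0F ∷ 4F ∷ 2F ∷ 3F ∷ 1F ∷ []) ∷
  perm (0F ∷ 4F ∷ 3F ∷ 1F ∷ 2F ∷ []) ∷
  perm (0F ∷ 4F ∷ 3F ∷ 2F ∷ 1F ∷ []) ∷
  perm (2F ∷ 3F ∷ 0F ∷ 1F ∷ 4F ∷ []) ∷
  []
B₅ =
  perm (2F ∷ 3F ∷ 0F ∷ 1F ∷ 4F ∷ []) ∷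
  perm (3F ∷ 2F ∷ 0F ∷ 1F ∷ 4F ∷ []) ∷
  perm (3F ∷ 1F ∷ 2F ∷ 0F ∷ 4F ∷ []) ∷
  perm (2F ∷ 3F ∷ 1F ∷ 0F ∷ 4F ∷ []) ∷
  perm (3F ∷ 2F ∷ 1F ∷ 0F ∷ 4F ∷ []) ∷
  perm (0F ∷ 3F ∷ 4F ∷ 1F ∷ 2F ∷ []) ∷
  []

good₄ : List (List ℕ)
good₄ =
  (1 ∷ 4 ∷ 3 ∷ 2 ∷ []) ∷
  (4 ∷ 2 ∷ 3 ∷ 1 ∷ []) ∷
  (4 ∷ 3 ∷ 2 ∷ 1 ∷ []) ∷
  []

good₅ : List (List ℕ)
good₅ =
  (1 ∷ 4 ∷ 5 ∷ 2 ∷ 3 ∷ []) ∷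
  (1 ∷ 4 ∷ 5 ∷ 3 ∷ 2 ∷ []) ∷
  (1 ∷ 5 ∷ 3 ∷ 4 ∷ 2 ∷ []) ∷
  (1 ∷ 5 ∷ 4 ∷ 2 ∷ 3 ∷ []) ∷
  (1 ∷ 5 ∷ 4 ∷ 3 ∷ 2 ∷ []) ∷
  (3 ∷ 4 ∷ 1 ∷ 2 ∷ 5 ∷ []) ∷
  (5 ∷ 2 ∷ 3 ∷ 4 ∷ 1 ∷ []) ∷
  (5 ∷ 2 ∷ 4 ∷ 3 ∷ 1 ∷ []) ∷
  (5 ∷ 3 ∷ 2 ∷ 4 ∷ 1 ∷ []) ∷
  (5 ∷ 3 ∷ 4 ∷ 2 ∷ 1 ∷ []) ∷
  (5 ∷ 4 ∷ 2 ∷ 3 ∷ 1 ∷ []) ∷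
  (5 ∷ 4 ∷ 3 ∷ 2 ∷ 1 ∷ []) ∷
  []

compatible₄ : ∀ p → Listed A₄ p → FCompatible p
compatible₄ = listed⇒compatible A₄ B₄ (toWitness {a? = closed? A₄ B₄} tt)

compatible₅ : ∀ p → Listed A₅ p → FCompatible p
compatible₅ = listed⇒compatible A₅ B₅ (toWitness {a? = closed? A₅ B₅} tt)

verdicts₄ : All (Verdict A₄ good₄ instances) (perms 4)
verdicts₄ = toWitness {a? = All.all? (verdict? A₄ good₄ instances) (perms 4)} tt

verdicts₅ : All (Verdict A₅ good₅ instances) (perms 5)
verdicts₅ = toWitness {a? = All.all? (verdict? A₅ good₅ instances) (perms 5)} tt

mainTheorem16 : ((p : Permutation′ 4) →
    (Avoids p [1324] × FCompatible p) ⇔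
    (oneLine p ∈
    (1 ∷ 4 ∷ 3 ∷ 2 ∷ []) ∷
    (4 ∷ 2 ∷ 3 ∷ 1 ∷ []) ∷
    (4 ∷ 3 ∷ 2 ∷ 1 ∷ []) ∷ [])) ×
    ((p : Permutation′ 5) →
    (Avoids p [1324] × FCompatible p) ⇔
    (oneLine p ∈
    (1 ∷ 4 ∷ 5 ∷ 2 ∷ 3 ∷ []) ∷
    (1 ∷ 4 ∷ 5 ∷ 3 ∷ 2 ∷ []) ∷
    (1 ∷ 5 ∷ 3 ∷ 4 ∷ 2 ∷ []) ∷
    (1 ∷ 5 ∷ 4 ∷ 2 ∷ 3 ∷ []) ∷
    (1 ∷ 5 ∷ 4 ∷ 3 ∷ 2 ∷ []) ∷
    (3 ∷ 4 ∷ 1 ∷ 2 ∷ 5 ∷ []) ∷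
    (5 ∷ 2 ∷ 3 ∷ 4 ∷ 1 ∷ []) ∷
    (5 ∷ 2 ∷ 4 ∷ 3 ∷ 1 ∷ []) ∷
    (5 ∷ 3 ∷ 2 ∷ 4 ∷ 1 ∷ []) ∷
    (5 ∷ 3 ∷ 4 ∷ 2 ∷ 1 ∷ []) ∷
    (5 ∷ 4 ∷ 2 ∷ 3 ∷ 1 ∷ []) ∷
    (5 ∷ 4 ∷ 3 ∷ 2 ∷ 1 ∷ []) ∷ [])) ×
    (∀ {k : ℕ} (p : Permutation′ (suc k)) →
    p ⟨$⟩ʳ 0F ≡ fromℕ k → p ⟨$⟩ʳ fromℕ k ≡ 0F → FCompatible p)
mainTheorem16 =
  characterize A₄ good₄ instances compatible₄ verdicts₄ ,
  characterize A₅ good₅ instances compatible₅ verdicts₅ ,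
  λ p p₀ pₗ → endToEnd⇒compatible p (p₀ , pₗ)
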